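{- Let $S\in\mathcal{T}_2V$ and $\hat S\in\mathcal{T}_3V$ be symmetric tensors (invariant under all permutations of their arguments). Then $y_{t'}^{\ast}(S\otimes\hat S)=y_{t'}^{\ast}(\hat S\otimes S)$, and in coordinates with respect to any basis $$\big(y_{t'}^{\ast}(S\otimes\hat S)\big)_{ijkls}=\big(y_{t'}^{\ast}(\hat S\otimes S)\big)_{ijkls}=4\big\{S_{il}\hat S_{jks}-S_{jl}\hat S_{iks}+S_{jk}\hat S_{ils}-S_{ik}\hat S_{jls}\big\}.$$ Moreover, the vector space of all algebraic covariant derivative curvature tensors $\mathfrak R'\in\mathcal T_5V$ equals the set of all finite sums of tensors $y_{t'}^{\ast}(S\otimes\hat S)$ with $S\in\mathcal T_2V$, $\hat S\in\mathcal T_3V$ symmetric (equivalently, of tensors $y_{t'}^{\ast}(\hat S\otimes S)$).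
   Context: $\mathbb{K}=\mathbb{R}$ or $\mathbb{C}$; $V$ is a finite-dimensional $\mathbb{K}$-vector space, $\mathcal{T}_rV$ the space of $r$-times covariant tensors; coordinates $T_{i_1\dots i_r}=T(e_{i_1},\dots,e_{i_r})$ for a basis $(e_i)$. $(S\otimes\hat S)(v_1,\dots,v_5)=S(v_1,v_2)\hat S(v_3,v_4,v_5)$, $(\hat S\otimes S)(v_1,\dots,v_5)=\hat S(v_1,v_2,v_3)S(v_4,v_5)$. Permutations multiply by $(p\circ q)(i)=p(q(i))$. An element $a=\sum_{p}a(p)\,p\in\mathbb{K}[\mathcal{S}_r]$ acts on $T\in\mathcal{T}_rV$ by $(aT)(v_1,\dots,v_r)=\sum_p a(p)\,T(v_{p(1)},\dots,v_{p(r)})$, i.e. $(aT)_{i_1\dots i_r}=\sum_p a(p)T_{i_{p(1)}\dots i_{p(r)}}$; and $a^{\ast}:=\sum_p a(p)\,p^{ -1}$. For a Young tableau $t$, $y_t=\sum_{p\in\mathcal H_t}\sum_{q\in\mathcal V_t}\mathrm{sign}(q)\,p\circ q$, with $\mathcal H_t$ ($\mathcal V_t$) the row- (column-) preserving permutations. $t'$ is the Young tableau with rows $(1,3,5)$ and $(2,4)$. An algebraic covariant derivative curvature tensor is a tensor $\mathfrak{R}'\in\mathcal{T}_5V$ with, for all $u,w,x,y,z\in V$: $\mathfrak R'(w,x,y,z,u)=-\mathfrak R'(w,x,z,y,u)=\mathfrak R'(y,z,w,x,u)$, $\mathfrak R'(w,x,y,z,u)+\mathfrak R'(w,y,z,x,u)+\mathfrak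 R'(w,z,x,y,u)=0$, and $\mathfrak R'(w,x,y,z,u)+\mathfrak R'(w,x,z,u,y)+\mathfrak R'(w,x,u,y,z)=0$. -}

module Defs where

open import Algebra.Bundles using (CommutativeRing)
import Algebra.Definitions.RawMonoid as RawMonoid
import Algebra.Consequences.Setoid as Consequences
open import Algebra.Definitions
  using (Congruent₂; Commutative; LeftIdentity; _DistributesOverˡ_)
open import Algebra.Module.Bundles using (Module)
import Algebra.Properties.CommutativeSemigroup as SemigroupProperties
import Algebra.Properties.CommutativeMonoid.Sum as Sum
import Algebra.Properties.Ring as RingProperties
import Algebra.Solver.Ring.NaturalCoefficients.Default as SemiringSolver
open import Data.Fin.Base using (Fin; zero; suc; toℕ; fromℕ<; splitAt; _↑ˡ_; _↑ʳ_)
open import Data.Fin.Patterns using (0F; 1F; 2F; 3F; 4F)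
import Data.Fin.Permutation as Perm
open import Data.Fin.Permutation using (Permutation′; _⟨$⟩ʳ_; _⟨$⟩ˡ_; _∘ₚ_; insert)
open import Data.Fin.Properties
  using (_<?_; toℕ-fromℕ<; all?; any?; ↑ˡ-injective; ↑ʳ-injective; splitAt⁻¹-↑ˡ; splitAt⁻¹-↑ʳ;
         splitAt-↑ˡ; splitAt-↑ʳ)
import Data.Fin.Properties as Fin
open import Data.List.Base as List using (List; [_]; concatMap; allFin; filter)
open import Data.List.Relation.Unary.All using (All)
open import Data.Nat.Base as ℕ using (ℕ; zero; suc)
import Data.Nat.Properties as ℕ
open import Data.Product.Base using (∃; Σ; _×_; _,_)
open import Data.Rational.Base as Rat using (ℚ; 0ℚ; 1ℚ; ½; ∣_∣)
import Data.Rational.Properties as Rat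
open import Data.Sign.Base as Sign using (Sign)
open import Data.Sum.Base using (inj₁; inj₂)
open import Data.Vec.Functional as Vector using (Vector; updateAt; take; drop)
open import Data.Vec.Functional.Properties using (updateAt-updates; updateAt-minimal)
open import Function.Base using (_∘_; const)
open import Function.Bundles using (Injection)
open import Function.Properties.Inverse using (↔⇒↣)
open import Level using (0ℓ; _⊔_)
open import Relation.Binary.Bundles using (Setoid)
open import Relation.Binary.PropositionalEquality as ≡
  using (_≡_; _≢_; _≗_; cong; subst)
open import Relation.Binary.Structures using (IsEquivalence)
open import Relation.Nullary.Decidable using (Dec; yes; no; _×-dec_; _→-dec_; toWitness; dec⇒maybe)
open import Relation.Unary using (Pred)
open import Tactic.RingSolver using (solve-∀)
open import Tactic.RingSolver.Core.AlmostCommutativeRing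
  using (AlmostCommutativeRing; fromCommutativeRing)

module Reals where

  open ≡ using (refl; sym; trans)
  open import Data.Rational.Base using (_+_; _-_; _*_; -_; _<_)

  infix 4 _~_

  -- |x m - y n| → 0 as m, n → ∞.  In particular x ~ x says that x is a
  -- Cauchy sequence, and between Cauchy sequences _~_ is equality of limits.
  record _~_ (x y : ℕ → ℚ) : Set where
    constructor mk~
    field
      close : ∀ ε → 0ℚ < ε →
              ∃ λ N → ∀ m n → N ℕ.≤ m → N ℕ.≤ n → ∣ x m - y n ∣ < ε

  open _~_

  -- Cauchy sequences of rationals with an explicit modulus of convergence.
  record ℝ : Set where
    constructor mkℝ
    field
      seq    : ℕ → ℚ
      cauchy : seq ~ seq

  open ℝ

  infix 4 _≈_

  _≈_ : ℝ → ℝ → Set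
  x ≈ y = seq x ~ seq y

  private
    ℚ-ring : AlmostCommutativeRing 0ℓ 0ℓ
    ℚ-ring = fromCommutativeRing Rat.+-*-commutativeRing (λ q → dec⇒maybe (0ℚ Rat.≟ q))

    neg-sub : ∀ a b → - (a - b) ≡ b - a
    neg-sub = solve-∀ ℚ-ring

    sub-neg : ∀ a b → - (a - b) ≡ (- a) - (- b)
    sub-neg = solve-∀ ℚ-ring

    sub-add : ∀ a b → (a - b) + b ≡ a
    sub-add = solve-∀ ℚ-ring

    sub-sub : ∀ a b c → (a - b) + (b - c) ≡ a - c
    sub-sub = solve-∀ ℚ-ring

    add-sub : ∀ a b c d → (a - b) + (c - d) ≡ (a + c) - (b + d)
    add-sub = solve-∀ ℚ-ring

    mul-sub : ∀ a b c d → a * (c - d) + d * (a - b) ≡ a * c - b * d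
    mul-sub = solve-∀ ℚ-ring

    variable
      x y z u v : ℕ → ℚ

    half : ℚ → ℚ
    half ε = ½ * ε

    half-pos : ∀ {ε} → 0ℚ < ε → 0ℚ < half ε
    half-pos {ε} 0<ε = subst (_< half ε) (Rat.*-zeroʳ ½) (Rat.*-monoʳ-<-pos ½ 0<ε)

    half+half : ∀ ε → half ε + half ε ≡ ε
    half+half ε = trans (sym (Rat.*-distribʳ-+ ε ½ ½)) (Rat.*-identityˡ ε)

    ∣a+b∣<ε : ∀ {a b ε} → ∣ a ∣ < half ε → ∣ b ∣ < half ε → ∣ a + b ∣ < ε
    ∣a+b∣<ε {a} {b} {ε} p q = subst (∣ a + b ∣ <_) (half+half ε)
      (Rat.≤-<-trans (Rat.∣p+q∣≤∣p∣+∣q∣ a b) (Rat.+-mono-< p q))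

    ~-sym : x ~ y → y ~ x
    ~-sym {x} {y} x~y = mk~ λ ε 0<ε →
      let N , p = close x~y ε 0<ε in N , λ m n N≤m N≤n →
      subst (_< ε)
        (trans (sym (Rat.∣-p∣≡∣p∣ (x n - y m)))
               (cong ∣_∣ (neg-sub (x n) (y m))))
        (p n m N≤n N≤m)

    ~-trans : x ~ y → y ~ z → x ~ z
    ~-trans {x} {y} {z} x~y y~z = mk~ λ ε 0<ε →
      let M , p = close x~y (half ε) (half-pos 0<ε)
          N , q = close y~z (half ε) (half-pos 0<ε)
      in M ℕ.⊔ N , λ m n h k →
        subst (λ a → ∣ a ∣ < ε)
          (sub-sub (x m) (y n) (z n))
          (∣a+b∣<ε
            (p m n (ℕ.≤-trans (ℕ.m≤m⊔n M N) h) (ℕ.≤-trans (ℕ.m≤m⊔n M N) k))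
            (q n n (ℕ.≤-trans (ℕ.m≤n⊔m M N) k) (ℕ.≤-trans (ℕ.m≤n⊔m M N) k)))

    -- Pointwise equal sequences are related as soon as one of
    -- them is Cauchy, which transfers every ring law from ℚ.
    pointwise : (∀ n → x n ≡ y n) → x ~ x → x ~ y
    pointwise {x} x≗y x~x = mk~ λ ε 0<ε →
      let N , p = close x~x ε 0<ε in N , λ m n h k → subst (λ a → ∣ x m - a ∣ < ε) (x≗y n) (p m n h k)

    const-~ : ∀ q → (λ _ → q) ~ (λ _ → q)
    const-~ q = mk~ λ ε 0<ε → 0 , λ _ _ _ _ →
      subst (λ a → ∣ a ∣ < ε) (sym (Rat.+-inverseʳ q)) 0<ε

    +-~ : x ~ y → u ~ v → (λ n → x n + u n) ~ (λ n → y n + v n)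
    +-~ {x} {y} {u} {v} x~y u~v = mk~ λ ε 0<ε →
      let M , p = close x~y (half ε) (half-pos 0<ε)
          N , q = close u~v (half ε) (half-pos 0<ε)
      in M ℕ.⊔ N , λ m n h k →
        subst (λ a → ∣ a ∣ < ε)
          (add-sub (x m) (y n) (u m) (v n))
          (∣a+b∣<ε
            (p m n (ℕ.≤-trans (ℕ.m≤m⊔n M N) h) (ℕ.≤-trans (ℕ.m≤m⊔n M N) k))
            (q m n (ℕ.≤-trans (ℕ.m≤n⊔m M N) h) (ℕ.≤-trans (ℕ.m≤n⊔m M N) k)))

    neg-~ : x ~ y → (λ n → - x n) ~ (λ n → - y n)
    neg-~ {x} {y} x~y = mk~ λ ε 0<ε →
      let N , p = close x~y ε 0<ε in N , λ m n h k →
      subst (_< ε)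
        (trans (sym (Rat.∣-p∣≡∣p∣ (x m - y n)))
               (cong ∣_∣ (sub-neg (x m) (y n))))
        (p m n h k)

    bounded : x ~ x → ∃ λ B → 0ℚ < B × ∃ λ N → ∀ n → N ℕ.≤ n → ∣ x n ∣ < B
    bounded {x} x~x =
      let N , p = close x~x 1ℚ (Rat.positive⁻¹ 1ℚ) in 1ℚ + ∣ x N ∣ ,
      Rat.+-mono-<-≤ (Rat.positive⁻¹ 1ℚ) (Rat.0≤∣p∣ (x N)) ,
      N , λ n N≤n → subst (λ a → ∣ a ∣ < 1ℚ + ∣ x N ∣)
        (sub-add (x n) (x N))
        (Rat.≤-<-trans (Rat.∣p+q∣≤∣p∣+∣q∣ (x n - x N) (x N))
                     (Rat.+-monoˡ-< ∣ x N ∣ (p n N N≤n ℕ.≤-refl)))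

    shrink : ∀ B → 0ℚ < B → ∀ ε → 0ℚ < ε → ∃ λ δ → 0ℚ < δ ×
             (∀ {a b} → ∣ a ∣ < B → ∣ b ∣ < δ → ∣ a * b ∣ < ε)
    shrink B 0<B ε 0<ε = 1/B * ε , 0<δ , λ {a} {b} p q →
      subst (_< ε) (sym (Rat.∣p*q∣≡∣p∣*∣q∣ a b))
        (Rat.≤-<-trans
          (Rat.*-monoʳ-≤-nonNeg ∣ b ∣ {{Rat.nonNegative (Rat.0≤∣p∣ b)}} (Rat.<⇒≤ p))
          (subst (B * ∣ b ∣ <_) Bδ≡ε (Rat.*-monoʳ-<-pos B q)))
      where
      instance
        B-pos : Rat.Positive B
        B-pos = Rat.positive 0<B
        B-nonZero : Rat.NonZero B
        B-nonZero = Rat.pos⇒nonZero B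
      1/B : ℚ
      1/B = Rat.1/ B
      instance
        1/B-pos : Rat.Positive 1/B
        1/B-pos = Rat.1/pos⇒pos B
      0<δ : 0ℚ < 1/B * ε
      0<δ = subst (_< 1/B * ε) (Rat.*-zeroʳ 1/B) (Rat.*-monoʳ-<-pos 1/B 0<ε)
      Bδ≡ε : B * (1/B * ε) ≡ ε
      Bδ≡ε = trans (sym (Rat.*-assoc B 1/B ε))
                   (trans (cong (_* ε) (Rat.*-inverseʳ B)) (Rat.*-identityˡ ε))

    *-~ : x ~ x → v ~ v → x ~ y → u ~ v → (λ n → x n * u n) ~ (λ n → y n * v n)
    *-~ {x} {v} {y} {u} x~x v~v x~y u~v = mk~ λ ε 0<ε →
      let B , 0<B , K , b = bounded x~x
          C , 0<C , L , c = bounded v~v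
          δ , 0<δ , d     = shrink B 0<B (half ε) (half-pos 0<ε)
          η , 0<η , e     = shrink C 0<C (half ε) (half-pos 0<ε)
          M , p           = close u~v δ 0<δ
          N , q           = close x~y η 0<η
      in (K ℕ.⊔ L) ℕ.⊔ (M ℕ.⊔ N) , λ m n h k →
        let hKL = ℕ.m⊔n≤o⇒m≤o (K ℕ.⊔ L) (M ℕ.⊔ N) h
            kKL = ℕ.m⊔n≤o⇒m≤o (K ℕ.⊔ L) (M ℕ.⊔ N) k
            hMN = ℕ.m⊔n≤o⇒n≤o (K ℕ.⊔ L) (M ℕ.⊔ N) h
            kMN = ℕ.m⊔n≤o⇒n≤o (K ℕ.⊔ L) (M ℕ.⊔ N) k
        in subst (λ a → ∣ a ∣ < ε) (mul-sub (x m) (y n) (u m) (v n))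
             (∣a+b∣<ε {x m * (u m - v n)} {v n * (x m - y n)}
               (d {x m} {u m - v n} (b m (ℕ.m⊔n≤o⇒m≤o K L hKL))
                  (p m n (ℕ.m⊔n≤o⇒m≤o M N hMN) (ℕ.m⊔n≤o⇒m≤o M N kMN)))
               (e {v n} {x m - y n} (c n (ℕ.m⊔n≤o⇒n≤o K L kKL))
                  (q m n (ℕ.m⊔n≤o⇒n≤o M N hMN) (ℕ.m⊔n≤o⇒n≤o M N kMN))))

  fromℚ : ℚ → ℝ
  fromℚ q = mkℝ (λ _ → q) (const-~ q)

  infixl 6 _⊕_
  infixl 7 _⊛_

  _⊕_ : ℝ → ℝ → ℝ
  x ⊕ y = mkℝ (λ n → seq x n + seq y n) (+-~ (cauchy x) (cauchy y))

  _⊛_ : ℝ → ℝ → ℝ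
  x ⊛ y = mkℝ (λ n → seq x n * seq y n)
              (*-~ (cauchy x) (cauchy y) (cauchy x) (cauchy y))

  ⊖_ : ℝ → ℝ
  ⊖ x = mkℝ (λ n → - seq x n) (neg-~ (cauchy x))

  ℝ-commutativeRing : CommutativeRing 0ℓ 0ℓ
  ℝ-commutativeRing = record
    { Carrier = ℝ
    ; _≈_ = _≈_
    ; _+_ = _⊕_
    ; _*_ = _⊛_
    ; -_  = ⊖_
    ; 0#  = fromℚ 0ℚ
    ; 1#  = fromℚ 1ℚ
    ; isCommutativeRing = record
      { isRing = record
        { +-isAbelianGroup = record
          { isGroup = record
            { isMonoid = record
              { isSemigroup = record
                { isMagma = record
                  { isEquivalence = record
                    { refl  = λ {x} → cauchy x
                    ; sym   = ~-sym
                    ; trans = ~-trans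
                    }
                  ; ∙-cong = +-~
                  }
                ; assoc = λ x y z → pointwise
                    (λ n → Rat.+-assoc (seq x n) (seq y n) (seq z n)) (cauchy (x ⊕ y ⊕ z))
                }
              ; identity =
                  (λ x → pointwise (λ n → Rat.+-identityˡ (seq x n)) (cauchy (fromℚ 0ℚ ⊕ x))) ,
                  (λ x → pointwise (λ n → Rat.+-identityʳ (seq x n)) (cauchy (x ⊕ fromℚ 0ℚ)))
              }
            ; inverse =
                (λ x → pointwise (λ n → Rat.+-inverseˡ (seq x n)) (cauchy (⊖ x ⊕ x))) ,
                (λ x → pointwise (λ n → Rat.+-inverseʳ (seq x n)) (cauchy (x ⊕ ⊖ x)))
            ; ⁻¹-cong = neg-~
            }
          ; comm = λ x y → pointwise (λ n → Rat.+-comm (seq x n) (seq y n)) (cauchy (x ⊕ y))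
          }
        ; *-cong = λ {x} {_} {_} {v} → *-~ (cauchy x) (cauchy v)
        ; *-assoc = λ x y z → pointwise
            (λ n → Rat.*-assoc (seq x n) (seq y n) (seq z n)) (cauchy (x ⊛ y ⊛ z))
        ; *-identity =
            (λ x → pointwise (λ n → Rat.*-identityˡ (seq x n)) (cauchy (fromℚ 1ℚ ⊛ x))) ,
            (λ x → pointwise (λ n → Rat.*-identityʳ (seq x n)) (cauchy (x ⊛ fromℚ 1ℚ)))
        ; distrib =
            (λ x y z → pointwise
              (λ n → Rat.*-distribˡ-+ (seq x n) (seq y n) (seq z n)) (cauchy (x ⊛ (y ⊕ z)))) ,
            (λ x y z → pointwise
              (λ n → Rat.*-distribʳ-+ (seq x n) (seq y n) (seq z n)) (cauchy ((y ⊕ z) ⊛ x)))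
        }
      ; *-comm = λ x y → pointwise (λ n → Rat.*-comm (seq x n) (seq y n)) (cauchy (x ⊛ y))
      }
    }

private
  -- Identities behind multiplication in K[X]/(X² - n), to be used at n = -1.
  module QuadraticIdentities {c ℓ} (R : CommutativeRing c ℓ) where

    open CommutativeRing R
    open SemiringSolver commutativeSemiring using (solve; _:=_; _:+_; _:*_)

    assoc-re : ∀ n a b c d e f →
      (a * c + n * (b * d)) * e + n * ((a * d + b * c) * f) ≈
      a * (c * e + n * (d * f)) + n * (b * (c * f + d * e))
    assoc-re = solve 7 (λ n a b c d e f →
      (a :* c :+ n :* (b :* d)) :* e :+ n :* ((a :* d :+ b :* c) :* f) :=
      a :* (c :* e :+ n :* (d :* f)) :+ n :* (b :* (c :* f :+ d :* e))) refl

    assoc-im : ∀ n a b c d e f →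
      (a * c + n * (b * d)) * f + (a * d + b * c) * e ≈
      a * (c * f + d * e) + b * (c * e + n * (d * f))
    assoc-im = solve 7 (λ n a b c d e f →
      (a :* c :+ n :* (b :* d)) :* f :+ (a :* d :+ b :* c) :* e :=
      a :* (c :* f :+ d :* e) :+ b :* (c :* e :+ n :* (d :* f))) refl

    distrib-re : ∀ n a b c d e f →
      a * (c + e) + n * (b * (d + f)) ≈ (a * c + n * (b * d)) + (a * e + n * (b * f))
    distrib-re = solve 7 (λ n a b c d e f →
      a :* (c :+ e) :+ n :* (b :* (d :+ f)) :=
      (a :* c :+ n :* (b :* d)) :+ (a :* e :+ n :* (b :* f))) refl

    distrib-im : ∀ a b c d e f →
      a * (d + f) + b * (c + e) ≈ (a * d + b * c) + (a * f + b * e)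
    distrib-im = solve 6 (λ a b c d e f →
      a :* (d :+ f) :+ b :* (c :+ e) := (a :* d :+ b :* c) :+ (a :* f :+ b :* e)) refl

module Complexification {c ℓ} (R : CommutativeRing c ℓ) where

  open CommutativeRing R
  open RingProperties ring using (-0#≈0#; -1*x≈-x)

  record Complex : Set c where
    constructor _+i_
    field
      re im : Carrier

  open Complex

  record _≈ᶜ_ (w z : Complex) : Set ℓ where
    constructor _,ᶜ_
    field
      re≈ : re w ≈ re z
      im≈ : im w ≈ im z

  open _≈ᶜ_

  infixl 6 _+ᶜ_
  infixl 7 _*ᶜ_

  _+ᶜ_ _*ᶜ_ : Complex → Complex → Complex
  w +ᶜ z = (re w + re z) +i (im w + im z)
  w *ᶜ z = (re w * re z - im w * im z) +i (re w * im z + im w * re z)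

  -ᶜ_ : Complex → Complex
  -ᶜ z = (- re z) +i (- im z)

  0ᶜ 1ᶜ : Complex
  0ᶜ = 0# +i 0#
  1ᶜ = 1# +i 0#

  private
    module Quad = QuadraticIdentities R

    sub : ∀ x y → x - y ≈ x + - 1# * y
    sub x y = +-congˡ (sym (-1*x≈-x y))

    assoc-re : ∀ a b c d e f →
      (a * c - b * d) * e - (a * d + b * c) * f ≈ a * (c * e - d * f) - b * (c * f + d * e)
    assoc-re a b c d e f =
      trans (sub _ _) (trans (+-congʳ (*-congʳ (sub _ _)))
        (trans (Quad.assoc-re (- 1#) a b c d e f)
          (sym (trans (sub _ _) (+-congʳ (*-congˡ (sub _ _)))))))

    assoc-im : ∀ a b c d e f →
      (a * c - b * d) * f + (a * d + b * c) * e ≈ a * (c * f + d * e) + b * (c * e - d * f)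
    assoc-im a b c d e f =
      trans (+-congʳ (*-congʳ (sub _ _)))
        (trans (Quad.assoc-im (- 1#) a b c d e f)
          (sym (+-congˡ (*-congˡ (sub _ _)))))

    distrib-re : ∀ a b c d e f →
      a * (c + e) - b * (d + f) ≈ (a * c - b * d) + (a * e - b * f)
    distrib-re a b c d e f =
      trans (sub _ _) (trans (Quad.distrib-re (- 1#) a b c d e f)
        (sym (+-cong (sub _ _) (sub _ _))))

    ≈ᶜ-isEquivalence : IsEquivalence _≈ᶜ_
    ≈ᶜ-isEquivalence = record
      { refl  = refl ,ᶜ refl
      ; sym   = λ p → sym (re≈ p) ,ᶜ sym (im≈ p)
      ; trans = λ p q → trans (re≈ p) (re≈ q) ,ᶜ trans (im≈ p) (im≈ q)
      }

    *ᶜ-cong : Congruent₂ _≈ᶜ_ _*ᶜ_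
    *ᶜ-cong p q =
      +-cong (*-cong (re≈ p) (re≈ q)) (-‿cong (*-cong (im≈ p) (im≈ q))) ,ᶜ
      +-cong (*-cong (re≈ p) (im≈ q)) (*-cong (im≈ p) (re≈ q))

    *ᶜ-comm : Commutative _≈ᶜ_ _*ᶜ_
    *ᶜ-comm w z =
      +-cong (*-comm _ _) (-‿cong (*-comm _ _)) ,ᶜ
      trans (+-comm _ _) (+-cong (*-comm _ _) (*-comm _ _))

    *ᶜ-identityˡ : LeftIdentity _≈ᶜ_ 1ᶜ _*ᶜ_
    *ᶜ-identityˡ z =
      trans (+-cong (*-identityˡ _) (trans (-‿cong (zeroˡ _)) -0#≈0#)) (+-identityʳ _) ,ᶜ
      trans (+-cong (*-identityˡ _) (zeroˡ _)) (+-identityʳ _)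

    *ᶜ-distribˡ : _DistributesOverˡ_ _≈ᶜ_ _*ᶜ_ _+ᶜ_
    *ᶜ-distribˡ u w z =
      distrib-re (re u) (im u) (re w) (im w) (re z) (im z) ,ᶜ
      Quad.distrib-im (re u) (im u) (re w) (im w) (re z) (im z)

  commutativeRing : CommutativeRing c ℓ
  commutativeRing = record
    { Carrier = Complex
    ; _≈_ = _≈ᶜ_
    ; _+_ = _+ᶜ_
    ; _*_ = _*ᶜ_
    ; -_  = -ᶜ_
    ; 0#  = 0ᶜ
    ; 1#  = 1ᶜ
    ; isCommutativeRing = record
      { isRing = record
        { +-isAbelianGroup = record
          { isGroup = record
            { isMonoid = record
              { isSemigroup = record
                { isMagma = record
                  { isEquivalence = ≈ᶜ-isEquivalence
                  ; ∙-cong = λ p q → +-cong (re≈ p) (re≈ q) ,ᶜ +-cong (im≈ p) (im≈ q)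
                  }
                ; assoc = λ u w z → +-assoc _ _ _ ,ᶜ +-assoc _ _ _
                }
              ; identity = (λ z → +-identityˡ _ ,ᶜ +-identityˡ _) ,
                           (λ z → +-identityʳ _ ,ᶜ +-identityʳ _)
              }
            ; inverse = (λ z → -‿inverseˡ _ ,ᶜ -‿inverseˡ _) ,
                        (λ z → -‿inverseʳ _ ,ᶜ -‿inverseʳ _)
            ; ⁻¹-cong = λ p → -‿cong (re≈ p) ,ᶜ -‿cong (im≈ p)
            }
          ; comm = λ w z → +-comm _ _ ,ᶜ +-comm _ _
          }
        ; *-cong = *ᶜ-cong
        ; *-assoc = λ u w z →
            assoc-re (re u) (im u) (re w) (im w) (re z) (im z) ,ᶜ
            assoc-im (re u) (im u) (re w) (im w) (re z) (im z)
        ; *-identity = Consequences.comm∧idˡ⇒id ≈ᶜ-setoid *ᶜ-comm *ᶜ-identityˡ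
        ; distrib = Consequences.comm∧distrˡ⇒distr ≈ᶜ-setoid
            (λ p q → +-cong (re≈ p) (re≈ q) ,ᶜ +-cong (im≈ p) (im≈ q))
            *ᶜ-comm *ᶜ-distribˡ
        }
      ; *-comm = *ᶜ-comm
      }
    }
    where
    ≈ᶜ-setoid : Setoid c ℓ
    ≈ᶜ-setoid = record { isEquivalence = ≈ᶜ-isEquivalence }

-- The two choices of the ground field; a 𝕂-vector space is a Module over
-- `scalars 𝕂`.
data ScalarField : Set where
  real complex : ScalarField

scalars : ScalarField → CommutativeRing 0ℓ 0ℓ
scalars real    = Reals.ℝ-commutativeRing
scalars complex = Complexification.commutativeRing Reals.ℝ-commutativeRing

-- Every permutation of Fin n, exactly once: p is determined by p(0) and the
-- bijection it induces between the remaining points.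
permutations : ∀ n → List (Permutation′ n)
permutations zero    = [ Perm.id ]
permutations (suc n) =
  concatMap (λ j → List.map (insert zero j) (permutations n)) (allFin (suc n))

inversions : ∀ {n} → Permutation′ n → List (Fin n × Fin n)
inversions {n} p = filter
  (λ (i , j) → (i <? j) ×-dec (p ⟨$⟩ʳ j <? p ⟨$⟩ʳ i))
  (List.cartesianProduct (allFin n) (allFin n))

-- (-1) to the number of inversions.
sign : ∀ {n} → Permutation′ n → Sign
sign p = List.foldr (λ _ → Sign.opposite) Sign.+ (inversions p)

-- A filling of a Young diagram with r boxes by the numbers 0, …, r - 1: the
-- number i stands in row `row i` and column `col i`, both counted from 0.
record YoungTableau (r : ℕ) : Set where
  field
    row col   : Fin r → ℕ
    injective : ∀ i j → row i ≡ row j → col i ≡ col j → i ≡ j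
    diagram   : ∀ k a b → a ℕ.≤ row k → b ℕ.≤ col k → ∃ λ i → row i ≡ a × col i ≡ b

module _ {r} (t : YoungTableau r) where

  open YoungTableau t

  RowPreserving ColumnPreserving : Permutation′ r → Set
  RowPreserving    p = ∀ i → row (p ⟨$⟩ʳ i) ≡ row i
  ColumnPreserving p = ∀ i → col (p ⟨$⟩ʳ i) ≡ col i

  rowPreserving? : ∀ p → Dec (RowPreserving p)
  rowPreserving? p = all? λ i → row (p ⟨$⟩ʳ i) ℕ.≟ row i

  columnPreserving? : ∀ p → Dec (ColumnPreserving p)
  columnPreserving? p = all? λ i → col (p ⟨$⟩ʳ i) ℕ.≟ col i

  rowGroup columnGroup : List (Permutation′ r)
  rowGroup    = filter rowPreserving? (permutations r)
  columnGroup = filter columnPreserving? (permutations r)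

-- Rows (1,3,5) and (2,4), the entry k being represented by k - 1.
t′ : YoungTableau 5
t′ = record { row = row ; col = col ; injective = injective ; diagram = diagram }
  where
  row col : Fin 5 → ℕ
  row = λ { 0F → 0 ; 1F → 1 ; 2F → 0 ; 3F → 1 ; 4F → 0 }
  col = λ { 0F → 0 ; 1F → 0 ; 2F → 1 ; 3F → 1 ; 4F → 2 }

  injective : ∀ i j → row i ≡ row j → col i ≡ col j → i ≡ j
  injective = toWitness {a? = all? λ i → all? λ j →
    (row i ℕ.≟ row j) →-dec ((col i ℕ.≟ col j) →-dec (i Fin.≟ j))} _

  diagram< : ∀ k (a : Fin (suc (row k))) (b : Fin (suc (col k))) →
             ∃ λ i → row i ≡ toℕ a × col i ≡ toℕ b
  diagram< = toWitness {a? = all? λ k → all? λ a → all? λ b → any? λ i →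
    (row i ℕ.≟ toℕ a) ×-dec (col i ℕ.≟ toℕ b)} _

  diagram : ∀ k a b → a ℕ.≤ row k → b ℕ.≤ col k → ∃ λ i → row i ≡ a × col i ≡ b
  diagram k a b a≤ b≤
    with i , p , q ← diagram< k (fromℕ< (ℕ.s≤s a≤)) (fromℕ< (ℕ.s≤s b≤)) =
    i , ≡.trans p (toℕ-fromℕ< (ℕ.s≤s a≤)) , ≡.trans q (toℕ-fromℕ< (ℕ.s≤s b≤))

module GroupRing {c ℓ} (K : CommutativeRing c ℓ) where

  open CommutativeRing K

  -- Elements of K[S_r] as formal sums of terms a · p.  Several terms may
  -- share the same p: its coefficient is then the sum of theirs.
  K[S_] : ℕ → Set c
  K[S r ] = List (Carrier × Permutation′ r)

  infix 10 _⋆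

  -- The linear extension of p ↦ p⁻¹.
  _⋆ : ∀ {r} → K[S r ] → K[S r ]
  _⋆ = List.map λ (a , p) → a , Perm.flip p

  fromSign : Sign → Carrier
  fromSign Sign.+ = 1#
  fromSign Sign.- = - 1#

  -- The Young symmetrizer; q ∘ₚ p is the map i ↦ p (q i).
  y[_] : ∀ {r} → YoungTableau r → K[S r ]
  y[ t ] = concatMap
    (λ p → List.map (λ q → fromSign (sign q) , q ∘ₚ p) (columnGroup t))
    (rowGroup t)

infix 8 _[_]≔_

_[_]≔_ : ∀ {a n} {A : Set a} → Vector A n → Fin n → A → Vector A n
v [ i ]≔ x = updateAt v i (const x)

private
  module _ {a m n} {A : Set a} (f : Fin m → Fin n) (v : Vector A n) where

    update-image : (∀ {i j} → f i ≡ f j → i ≡ j) → ∀ i x →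
                   (v [ f i ]≔ x) ∘ f ≗ (v ∘ f) [ i ]≔ x
    update-image f-inj i x j with i Fin.≟ j
    ... | yes ≡.refl = ≡.trans (updateAt-updates (f i) v)
                               (≡.sym (updateAt-updates i (v ∘ f)))
    ... | no  i≢j    = ≡.trans (updateAt-minimal (f j) (f i) v (i≢j ∘ ≡.sym ∘ f-inj))
                               (≡.sym (updateAt-minimal j i (v ∘ f) (i≢j ∘ ≡.sym)))

    update-outside : ∀ {k} → (∀ j → f j ≢ k) → ∀ x → (v [ k ]≔ x) ∘ f ≗ v ∘ f
    update-outside {k} f≢k x j = updateAt-minimal (f j) k v (f≢k j)

  ↑ˡ≢↑ʳ : ∀ {m n} (i : Fin m) (j : Fin n) → i ↑ˡ n ≢ m ↑ʳ j
  ↑ˡ≢↑ʳ {m} {n} i j eq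
    with () ← ≡.trans (≡.sym (splitAt-↑ˡ m i n))
                      (≡.trans (cong (splitAt m) eq) (splitAt-↑ʳ m n j))

  ↑-elim : ∀ {p} m {n} (P : Fin (m ℕ.+ n) → Set p) →
           (∀ i → P (i ↑ˡ n)) → (∀ j → P (m ↑ʳ j)) → ∀ k → P k
  ↑-elim m P l r k with splitAt m k in eq
  ... | inj₁ i = subst P (splitAt⁻¹-↑ˡ eq) (l i)
  ... | inj₂ j = subst P (splitAt⁻¹-↑ʳ eq) (r j)

module Tensors {c ℓ m ℓm} {K : CommutativeRing c ℓ} (V : Module K m ℓm) where

  open CommutativeRing K
  open Module V using (Carrierᴹ; _≈ᴹ_; _+ᴹ_; _*ₗ_; 0ᴹ; ≈ᴹ-reflexive; +ᴹ-commutativeMonoid)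
  open Sum +ᴹ-commutativeMonoid using (sum)
  open RawMonoid +-rawMonoid public using () renaming (_×_ to _×ᴷ_)
  open GroupRing K public

  LinearCombination : ∀ {n} → Vector Carrier n → Vector Carrierᴹ n → Carrierᴹ
  LinearCombination a e = sum (λ i → a i *ₗ e i)

  record IsBasis {n} (e : Vector Carrierᴹ n) : Set (c ⊔ ℓ ⊔ m ⊔ ℓm) where
    field
      independent : ∀ a → LinearCombination a e ≈ᴹ 0ᴹ → ∀ i → a i ≈ 0#
      spanning    : ∀ v → ∃ λ a → LinearCombination a e ≈ᴹ v

  FiniteDimensional : Set (c ⊔ ℓ ⊔ m ⊔ ℓm)
  FiniteDimensional = ∃ λ n → Σ (Vector Carrierᴹ n) IsBasis

  record Tensor (r : ℕ) : Set (c ⊔ ℓ ⊔ m ⊔ ℓm) where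
    field
      ⟦_⟧         : Vector Carrierᴹ r → Carrier
      ⟦⟧-cong     : ∀ {v w} → (∀ i → v i ≈ᴹ w i) → ⟦_⟧ v ≈ ⟦_⟧ w
      additive    : ∀ v i x y →
                    ⟦_⟧ (v [ i ]≔ (x +ᴹ y)) ≈ ⟦_⟧ (v [ i ]≔ x) + ⟦_⟧ (v [ i ]≔ y)
      homogeneous : ∀ v i a x →
                    ⟦_⟧ (v [ i ]≔ (a *ₗ x)) ≈ a * ⟦_⟧ (v [ i ]≔ x)

    ⟦⟧-cong-≗ : ∀ {v w} → v ≗ w → ⟦_⟧ v ≈ ⟦_⟧ w
    ⟦⟧-cong-≗ v≗w = ⟦⟧-cong (λ i → ≈ᴹ-reflexive (v≗w i))

  open Tensor public using (⟦_⟧)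
  open Tensor

  infix  4 _≈ᵀ_
  infixl 6 _+ᵀ_
  infixr 7 _*ᵀ_
  infixl 7 _⊗_
  infixr 7 _▷_

  _≈ᵀ_ : ∀ {r} → Tensor r → Tensor r → Set (ℓ ⊔ m)
  S ≈ᵀ T = ∀ v → ⟦ S ⟧ v ≈ ⟦ T ⟧ v

  coords : ∀ {r n} → Tensor r → Vector Carrierᴹ n → Vector (Fin n) r → Carrier
  coords T e i = ⟦ T ⟧ (e ∘ i)

  0ᵀ : ∀ {r} → Tensor r
  0ᵀ = record
    { ⟦_⟧         = λ _ → 0#
    ; ⟦⟧-cong     = λ _ → refl
    ; additive    = λ _ _ _ _ → sym (+-identityˡ 0#)
    ; homogeneous = λ _ _ a _ → sym (zeroʳ a)
    }

  _+ᵀ_ : ∀ {r} → Tensor r → Tensor r → Tensor r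
  S +ᵀ T = record
    { ⟦_⟧         = λ v → ⟦ S ⟧ v + ⟦ T ⟧ v
    ; ⟦⟧-cong     = λ v≈w → +-cong (⟦⟧-cong S v≈w) (⟦⟧-cong T v≈w)
    ; additive    = λ v i x y →
        trans (+-cong (additive S v i x y) (additive T v i x y)) (interchange _ _ _ _)
    ; homogeneous = λ v i a x →
        trans (+-cong (homogeneous S v i a x) (homogeneous T v i a x))
              (sym (distribˡ a _ _))
    }
    where open SemigroupProperties +-commutativeSemigroup using (interchange)

  _*ᵀ_ : ∀ {r} → Carrier → Tensor r → Tensor r
  b *ᵀ T = record
    { ⟦_⟧         = λ v → b * ⟦ T ⟧ v
    ; ⟦⟧-cong     = λ v≈w → *-congˡ (⟦⟧-cong T v≈w)
    ; additive    = λ v i x y → trans (*-congˡ (additive T v i x y)) (distribˡ b _ _)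
    ; homogeneous = λ v i a x → trans (*-congˡ (homogeneous T v i a x)) (x∙yz≈y∙xz b a _)
    }
    where open SemigroupProperties *-commutativeSemigroup using (x∙yz≈y∙xz)

  sumᵀ : ∀ {r} → List (Tensor r) → Tensor r
  sumᵀ = List.foldr _+ᵀ_ 0ᵀ

  permute : ∀ {r} → Permutation′ r → Tensor r → Tensor r
  permute {r} p T = record
    { ⟦_⟧         = λ v → ⟦ T ⟧ (v ∘ (p ⟨$⟩ʳ_))
    ; ⟦⟧-cong     = λ v≈w → ⟦⟧-cong T (λ i → v≈w (p ⟨$⟩ʳ i))
    ; additive    = λ v i x y →
        trans (move v i (x +ᴹ y))
              (trans (additive T _ (p ⟨$⟩ˡ i) x y)
                     (sym (+-cong (move v i x) (move v i y))))
    ; homogeneous = λ v i a x →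
        trans (move v i (a *ₗ x))
              (trans (homogeneous T _ (p ⟨$⟩ˡ i) a x) (*-congˡ (sym (move v i x))))
    }
    where
    move : ∀ v i x → ⟦ T ⟧ ((v [ i ]≔ x) ∘ (p ⟨$⟩ʳ_)) ≈
                     ⟦ T ⟧ ((v ∘ (p ⟨$⟩ʳ_)) [ p ⟨$⟩ˡ i ]≔ x)
    move v i x = ⟦⟧-cong-≗ T (subst
      (λ k → (v [ k ]≔ x) ∘ (p ⟨$⟩ʳ_) ≗ (v ∘ (p ⟨$⟩ʳ_)) [ p ⟨$⟩ˡ i ]≔ x)
      (Perm.inverseʳ p)
      (update-image (p ⟨$⟩ʳ_) v (Injection.injective (↔⇒↣ p)) (p ⟨$⟩ˡ i) x))

  _⊗_ : ∀ {r s} → Tensor r → Tensor s → Tensor (r ℕ.+ s)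
  _⊗_ {r} {s} S T = record
    { ⟦_⟧         = λ v → ⟦ S ⟧ (take r v) * ⟦ T ⟧ (drop r v)
    ; ⟦⟧-cong     = λ v≈w → *-cong (⟦⟧-cong S (λ i → v≈w (i ↑ˡ s)))
                                   (⟦⟧-cong T (λ i → v≈w (r ↑ʳ i)))
    ; additive    = λ v → ↑-elim r _
        (λ i x y → trans (onˡ v i (x +ᴹ y))
          (trans (*-congʳ (additive S _ i x y))
            (trans (distribʳ _ _ _) (sym (+-cong (onˡ v i x) (onˡ v i y))))))
        (λ i x y → trans (onʳ v i (x +ᴹ y))
          (trans (*-congˡ (additive T _ i x y))
            (trans (distribˡ _ _ _) (sym (+-cong (onʳ v i x) (onʳ v i y))))))
    ; homogeneous = λ v → ↑-elim r _
        (λ i a x → trans (onˡ v i (a *ₗ x))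
          (trans (*-congʳ (homogeneous S _ i a x))
            (trans (*-assoc a _ _) (*-congˡ (sym (onˡ v i x))))))
        (λ i a x → trans (onʳ v i (a *ₗ x))
          (trans (*-congˡ (homogeneous T _ i a x))
            (trans (x∙yz≈y∙xz _ a _) (*-congˡ (sym (onʳ v i x))))))
    }
    where
    open SemigroupProperties *-commutativeSemigroup using (x∙yz≈y∙xz)

    onˡ : ∀ v i x → ⟦ S ⟧ (take r (v [ i ↑ˡ s ]≔ x)) * ⟦ T ⟧ (drop r (v [ i ↑ˡ s ]≔ x)) ≈
                    ⟦ S ⟧ (take r v [ i ]≔ x) * ⟦ T ⟧ (drop r v)
    onˡ v i x = *-cong
      (⟦⟧-cong-≗ S (update-image (_↑ˡ s) v (↑ˡ-injective s _ _) i x))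
      (⟦⟧-cong-≗ T (update-outside (r ↑ʳ_) v (λ j → ↑ˡ≢↑ʳ i j ∘ ≡.sym) x))

    onʳ : ∀ v i x → ⟦ S ⟧ (take r (v [ r ↑ʳ i ]≔ x)) * ⟦ T ⟧ (drop r (v [ r ↑ʳ i ]≔ x)) ≈
                    ⟦ S ⟧ (take r v) * ⟦ T ⟧ (drop r v [ i ]≔ x)
    onʳ v i x = *-cong
      (⟦⟧-cong-≗ S (update-outside (_↑ˡ s) v (λ j → ↑ˡ≢↑ʳ j i) x))
      (⟦⟧-cong-≗ T (update-image (r ↑ʳ_) v (↑ʳ-injective r _ _) i x))

  -- (a T)(v₁, …, v_r) = Σ a(p) T(v_{p(1)}, …, v_{p(r)})
  _▷_ : ∀ {r} → K[S r ] → Tensor r → Tensor r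
  a ▷ T = sumᵀ (List.map (λ (c , p) → c *ᵀ permute p T) a)

  Symmetric : ∀ {r} → Tensor r → Set (ℓ ⊔ m)
  Symmetric T = ∀ p → permute p T ≈ᵀ T

  record IsCovariantDerivativeCurvature (R : Tensor 5) : Set (ℓ ⊔ m) where
    private
      ⟨_,_,_,_,_⟩ : (w x y z u : Carrierᴹ) → Carrier
      ⟨ w , x , y , z , u ⟩ = ⟦ R ⟧ (w Vector.∷ x Vector.∷ y Vector.∷ z Vector.∷ u Vector.∷ Vector.[])
    field
      antisymmetry  : ∀ u w x y z → ⟨ w , x , y , z , u ⟩ ≈ - ⟨ w , x , z , y , u ⟩
      pairSymmetry  : ∀ u w x y z → ⟨ w , x , y , z , u ⟩ ≈ ⟨ y , z , w , x , u ⟩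
      firstBianchi  : ∀ u w x y z →
        ⟨ w , x , y , z , u ⟩ + ⟨ w , y , z , x , u ⟩ + ⟨ w , z , x , y , u ⟩ ≈ 0#
      secondBianchi : ∀ u w x y z →
        ⟨ w , x , y , z , u ⟩ + ⟨ w , x , z , u , y ⟩ + ⟨ w , x , u , y , z ⟩ ≈ 0#

  FiniteSumsOf : ∀ {r p} → Pred (Tensor r) p → Pred (Tensor r) (c ⊔ ℓ ⊔ m ⊔ ℓm ⊔ p)
  FiniteSumsOf P T = ∃ λ Ts → All P Ts × T ≈ᵀ sumᵀ Ts

module Submission where

-- Let A be the alternation over the columns {1, 2}, {3, 4} of t′.  Summing over the column group
-- first, y* (S ⊗ Ŝ) is a sum of twelve terms A (S_ab Ŝ_cde).  Such a term vanishes unless {a, b}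
-- meets both columns, and the four terms that remain are all equal to -A (S₂₄ Ŝ₁₃₅); the same holds
-- for Ŝ ⊗ S.  This is the formula, and its symmetries are those of a curvature tensor.
--
-- Conversely, let R be a curvature tensor and F(x, y, z; p, q) the sum of R(x, p, y, q, z) over the
-- permutations of x, y, z.  The Bianchi identities give A F = 12 R, where F is evaluated at
-- (v₁, v₃, v₅; v₂, v₄).  If φᵢ are the coordinates with respect to a basis (eᵢ), then expanding F in
-- p and q yields 2 F = Σᵢⱼ (φᵢ ⊗ φⱼ + φⱼ ⊗ φᵢ) F(·, ·, ·; eᵢ, eⱼ), so that
-- R = -1/96 Σᵢⱼ y* ((φᵢ ⊗ φⱼ + φⱼ ⊗ φᵢ) ⊗ F(·, ·, ·; eᵢ, eⱼ)).

open import Defs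
open import Algebra.Bundles using (CommutativeRing; CommutativeMonoid)
import Algebra.Definitions.RawMonoid as RawMonoid
open import Algebra.Module.Bundles using (Module)
import Algebra.Properties.AbelianGroup as AbelianGroupProperties
import Algebra.Properties.CommutativeSemigroup as SemigroupProperties
import Algebra.Properties.Ring as RingProperties
import Algebra.Properties.Semiring.Mult as SemiringMult
import Algebra.Properties.Semiring.Sum as SemiringSum
import Algebra.Solver.Ring as RingSolver
open import Algebra.Solver.Ring.AlmostCommutativeRing
  using (_-Raw-AlmostCommutative⟶_; fromCommutativeRing)
open import Data.Bool.Base using (true; false; if_then_else_)
open import Data.Fin.Base using (Fin; zero; suc; toℕ)
open import Data.Fin.Patterns using (0F; 1F; 2F; 3F; 4F; 5F; 6F; 7F; 8F; 9F)
import Data.Fin.Permutation as Perm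
open import Data.Fin.Permutation using (Permutation′; _⟨$⟩ʳ_; _∘ₚ_)
import Data.Fin.Properties as Fin
open import Data.Integer.Base as ℤ using (ℤ; +_; -[1+_]; +[1+_]; 0ℤ; 1ℤ; -1ℤ)
import Data.Integer.Properties as ℤ
open import Data.List.Base as List using (List; concatMap)
import Data.List.Properties as List
open import Data.List.Relation.Unary.All as All using (All)
import Data.List.Relation.Unary.All.Properties as All
open import Data.Maybe.Base using (Maybe; map)
open import Data.Nat.Base as ℕ using (ℕ; zero; suc)
import Data.Nat.Properties as ℕ
open import Data.Product.Base using (_×_; _,_; proj₁; proj₂; map₁; ∃; ∃₂)
import Data.Product.Properties as Product
import Data.Rational.Base as ℚ
open import Data.Sign.Base as Sign using (Sign)
import Data.Sign.Properties as Sign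
open import Data.Vec.Base as Vec using (Vec)
open import Data.Vec.Functional using (Vector; _∷_; [])
open import Data.Vec.Functional.Properties using (updateAt-updates; updateAt-minimal)
import Data.Vec.Properties as Vec
open import Function.Base using (_∘_)
open import Function.Bundles using (Injection)
open import Function.Properties.Inverse using (↔⇒↣)
open import Level using (_⊔_)
import Relation.Binary.Reasoning.Setoid as SetoidReasoning
open import Relation.Binary.Definitions using (DecidableEquality)
open import Relation.Binary.PropositionalEquality as ≡ using (_≡_; _≢_)
open import Relation.Nullary.Decidable using (dec⇒maybe; yes; no; ¬?; _→-dec_; toWitness)
open import Relation.Unary using (_≐_)

-- Integer coefficients let the solver cancel opposite terms although equality in R is not decidable.
module IntegerCoefficients {c ℓ} (R : CommutativeRing c ℓ) where

  open CommutativeRing R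
  open AbelianGroupProperties +-abelianGroup using (⁻¹-∙-comm; ⁻¹-involutive; ε⁻¹≈ε)
  open RingProperties ring using (-‿distribˡ-*; -‿distribʳ-*)
  open SemiringMult semiring using (×-homo-+; ×1-homo-*) renaming (_×_ to _×ᴷ_)
  open SetoidReasoning setoid

  -- The solver reads `con (+ n)` as `n ×ᴷ 1#` by definition, which is why numerical factors appear
  -- in that form below.
  fromℤ : ℤ → Carrier
  fromℤ (+ n)    = n ×ᴷ 1#
  fromℤ -[1+ n ] = - (suc n ×ᴷ 1#)

  private
    cancel : ∀ x y z → (x + y) - (x + z) ≈ y - z
    cancel x y z = begin
      (x + y) - (x + z)        ≈⟨ +-cong (+-comm y x) (⁻¹-∙-comm x z) ⟨
      (y + x) + (- x + - z)    ≈⟨ +-assoc y x _ ⟩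
      y + (x + (- x + - z))    ≈⟨ +-congˡ (+-assoc x _ _) ⟨
      y + ((x - x) + - z)      ≈⟨ +-congˡ (+-congʳ (-‿inverseʳ x)) ⟩
      y + (0# + - z)           ≈⟨ +-congˡ (+-identityˡ _) ⟩
      y - z                    ∎

    ⊖-homo : ∀ m n → fromℤ (m ℤ.⊖ n) ≈ m ×ᴷ 1# - n ×ᴷ 1#
    ⊖-homo m       zero    = sym (trans (+-congˡ ε⁻¹≈ε) (+-identityʳ _))
    ⊖-homo zero    (suc n) = sym (+-identityˡ _)
    ⊖-homo (suc m) (suc n) = begin
      fromℤ (suc m ℤ.⊖ suc n)      ≡⟨ ≡.cong fromℤ (ℤ.[1+m]⊖[1+n]≡m⊖n m n) ⟩
      fromℤ (m ℤ.⊖ n)              ≈⟨ ⊖-homo m n ⟩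
      m ×ᴷ 1# - n ×ᴷ 1#              ≈⟨ cancel 1# _ _ ⟨
      suc m ×ᴷ 1# - suc n ×ᴷ 1#      ∎

    neg-homo : ∀ i → fromℤ (ℤ.- i) ≈ - fromℤ i
    neg-homo (+ zero)  = sym ε⁻¹≈ε
    neg-homo +[1+ n ]  = refl
    neg-homo -[1+ n ]  = sym (⁻¹-involutive _)

    +-homo : ∀ i j → fromℤ (i ℤ.+ j) ≈ fromℤ i + fromℤ j
    +-homo (+ m)    (+ n)    = ×-homo-+ 1# m n
    +-homo (+ m)    -[1+ n ] = ⊖-homo m (suc n)
    +-homo -[1+ m ] (+ n)    = trans (⊖-homo n (suc m)) (+-comm _ _)
    +-homo -[1+ m ] -[1+ n ] = begin
      - (suc (suc (m ℕ.+ n)) ×ᴷ 1#)       ≡⟨ ≡.cong (λ k → - (k ×ᴷ 1#)) (≡.sym (ℕ.+-suc (suc m) n)) ⟩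
      - ((suc m ℕ.+ suc n) ×ᴷ 1#)         ≈⟨ -‿cong (×-homo-+ 1# (suc m) (suc n)) ⟩
      - (suc m ×ᴷ 1# + suc n ×ᴷ 1#)        ≈⟨ ⁻¹-∙-comm _ _ ⟨
      - (suc m ×ᴷ 1#) + - (suc n ×ᴷ 1#)    ∎

    *-homo-pos : ∀ m n → fromℤ (+ m ℤ.* + n) ≈ (m ×ᴷ 1#) * (n ×ᴷ 1#)
    *-homo-pos m n = begin
      fromℤ (+ m ℤ.* + n)      ≡⟨ ≡.cong fromℤ (ℤ.pos-* m n) ⟨
      (m ℕ.* n) ×ᴷ 1#           ≈⟨ ×1-homo-* m n ⟩
      (m ×ᴷ 1#) * (n ×ᴷ 1#)      ∎

    *-homo : ∀ i j → fromℤ (i ℤ.* j) ≈ fromℤ i * fromℤ j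
    *-homo (+ m)    (+ n)    = *-homo-pos m n
    *-homo (+ m)    -[1+ n ] = begin
      fromℤ (+ m ℤ.* -[1+ n ])           ≡⟨ ≡.cong fromℤ (ℤ.neg-distribʳ-* (+ m) +[1+ n ]) ⟨
      fromℤ (ℤ.- (+ m ℤ.* +[1+ n ]))     ≈⟨ neg-homo (+ m ℤ.* +[1+ n ]) ⟩
      - fromℤ (+ m ℤ.* +[1+ n ])         ≈⟨ -‿cong (*-homo-pos m (suc n)) ⟩
      - ((m ×ᴷ 1#) * (suc n ×ᴷ 1#))        ≈⟨ -‿distribʳ-* _ _ ⟩
      (m ×ᴷ 1#) * - (suc n ×ᴷ 1#)          ∎
    *-homo -[1+ m ] (+ n)    = begin
      fromℤ (-[1+ m ] ℤ.* + n)           ≡⟨ ≡.cong fromℤ (ℤ.neg-distribˡ-* +[1+ m ] (+ n)) ⟨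
      fromℤ (ℤ.- (+[1+ m ] ℤ.* + n))     ≈⟨ neg-homo (+[1+ m ] ℤ.* + n) ⟩
      - fromℤ (+[1+ m ] ℤ.* + n)         ≈⟨ -‿cong (*-homo-pos (suc m) n) ⟩
      - ((suc m ×ᴷ 1#) * (n ×ᴷ 1#))        ≈⟨ -‿distribˡ-* _ _ ⟩
      - (suc m ×ᴷ 1#) * (n ×ᴷ 1#)          ∎
    *-homo -[1+ m ] -[1+ n ] = begin
      (suc m ℕ.* suc n) ×ᴷ 1#             ≈⟨ ×1-homo-* (suc m) (suc n) ⟩
      (suc m ×ᴷ 1#) * (suc n ×ᴷ 1#)        ≈⟨ ⁻¹-involutive _ ⟨
      - - ((suc m ×ᴷ 1#) * (suc n ×ᴷ 1#))  ≈⟨ -‿cong (-‿distribʳ-* _ _) ⟩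
      - ((suc m ×ᴷ 1#) * - (suc n ×ᴷ 1#))  ≈⟨ -‿distribˡ-* _ _ ⟩
      - (suc m ×ᴷ 1#) * - (suc n ×ᴷ 1#)    ∎

    morphism : CommutativeRing.rawRing ℤ.+-*-commutativeRing -Raw-AlmostCommutative⟶
               fromCommutativeRing R
    morphism = record
      { ⟦_⟧    = fromℤ
      ; +-homo = +-homo
      ; *-homo = *-homo
      ; -‿homo = neg-homo
      ; 0-homo = refl
      ; 1-homo = +-identityʳ 1#
      }

    _≟_ : ∀ i j → Maybe (fromℤ i ≈ fromℤ j)
    i ≟ j = map (λ i≡j → reflexive (≡.cong fromℤ i≡j)) (dec⇒maybe (i ℤ.≟ j))

  open RingSolver (CommutativeRing.rawRing ℤ.+-*-commutativeRing) (fromCommutativeRing R) morphism _≟_ public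
    using (solve; prove; ⟦_⟧; Polynomial; var; con; _:=_; _:+_; _:*_; _:-_; :-_)

-- Algebra of curvature maps

module CurvatureMaps {α κ ℓ} (A : Set α) (K : CommutativeRing κ ℓ) where

  open CommutativeRing K
  open import Algebra.Definitions.RawMonoid +-rawMonoid renaming (_×_ to _×ᴷ_)
  open AbelianGroupProperties +-abelianGroup using (ε⁻¹≈ε)
  open IntegerCoefficients K
  open SetoidReasoning setoid

  -- The identities without multilinearity and for arguments of any type: all computations up to the
  -- expansion in a basis only rearrange arguments.
  record IsCurvatureMap (f : (w x y z u : A) → Carrier) : Set (α ⊔ ℓ) where
    field
      antisymmetry  : ∀ w x y z u → f w x y z u ≈ - f w x z y u
      pairSymmetry  : ∀ w x y z u → f w x y z u ≈ f y z w x u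
      firstBianchi  : ∀ w x y z u → f w x y z u + f w y z x u + f w z x y u ≈ 0#
      secondBianchi : ∀ w x y z u → f w x y z u + f w x z u y + f w x u y z ≈ 0#

  open IsCurvatureMap

  IsCurvatureMap-resp-≈ : ∀ {f g} → (∀ w x y z u → f w x y z u ≈ g w x y z u) →
                          IsCurvatureMap f → IsCurvatureMap g
  IsCurvatureMap-resp-≈ f≈g F = record
    { antisymmetry  = λ w x y z u →
        trans (sym (f≈g _ _ _ _ _)) (trans (antisymmetry F w x y z u) (-‿cong (f≈g _ _ _ _ _)))
    ; pairSymmetry  = λ w x y z u →
        trans (sym (f≈g _ _ _ _ _)) (trans (pairSymmetry F w x y z u) (f≈g _ _ _ _ _))
    ; firstBianchi  = λ w x y z u →
        trans (sym (+-cong (+-cong (f≈g _ _ _ _ _) (f≈g _ _ _ _ _)) (f≈g _ _ _ _ _)))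
              (firstBianchi F w x y z u)
    ; secondBianchi = λ w x y z u →
        trans (sym (+-cong (+-cong (f≈g _ _ _ _ _) (f≈g _ _ _ _ _)) (f≈g _ _ _ _ _)))
              (secondBianchi F w x y z u)
    }

  0-isCurvatureMap : IsCurvatureMap (λ _ _ _ _ _ → 0#)
  0-isCurvatureMap = record
    { antisymmetry  = λ _ _ _ _ _ → sym ε⁻¹≈ε
    ; pairSymmetry  = λ _ _ _ _ _ → refl
    ; firstBianchi  = λ _ _ _ _ _ → trans (+-identityʳ _) (+-identityʳ _)
    ; secondBianchi = λ _ _ _ _ _ → trans (+-identityʳ _) (+-identityʳ _)
    }

  +-isCurvatureMap : ∀ {f g} → IsCurvatureMap f → IsCurvatureMap g →
                     IsCurvatureMap (λ w x y z u → f w x y z u + g w x y z u)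
  +-isCurvatureMap F G = record
    { antisymmetry  = λ w x y z u →
        trans (+-cong (antisymmetry F w x y z u) (antisymmetry G w x y z u))
              (solve 2 (λ a b → :- a :+ :- b := :- (a :+ b)) refl _ _)
    ; pairSymmetry  = λ w x y z u → +-cong (pairSymmetry F w x y z u) (pairSymmetry G w x y z u)
    ; firstBianchi  = λ w x y z u → cyclic (firstBianchi F w x y z u) (firstBianchi G w x y z u)
    ; secondBianchi = λ w x y z u → cyclic (secondBianchi F w x y z u) (secondBianchi G w x y z u)
    }
    where
    cyclic : ∀ {a b c a′ b′ c′} → a + b + c ≈ 0# → a′ + b′ + c′ ≈ 0# →
             (a + a′) + (b + b′) + (c + c′) ≈ 0#
    cyclic p q = trans
      (solve 6 (λ a b c a′ b′ c′ →
        (a :+ a′) :+ (b :+ b′) :+ (c :+ c′) := (a :+ b :+ c) :+ (a′ :+ b′ :+ c′)) refl _ _ _ _ _ _)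
      (trans (+-cong p q) (+-identityʳ 0#))

  ×-isCurvatureMap : ∀ {f} n → IsCurvatureMap f → IsCurvatureMap (λ w x y z u → n ×ᴷ f w x y z u)
  ×-isCurvatureMap 0       F = 0-isCurvatureMap
  ×-isCurvatureMap (suc n) F = +-isCurvatureMap F (×-isCurvatureMap n F)

  module _ {s : A → A → Carrier} {t : A → A → A → Carrier}
           (s-sym : ∀ x y → s x y ≈ s y x)
           (t-sym₁₂ : ∀ x y z → t x y z ≈ t y x z) (t-sym₂₃ : ∀ x y z → t x y z ≈ t x z y) where

    -- Up to sign this is the Kulkarni-Nomizu product of `s` and `t(·, ·, u)`. In each Bianchi sum
    -- six products occur twice with opposite signs. The second Bianchi identity moves the last
    -- argument of `t` as well, hence `t-sym₂₃`.
    product-isCurvatureMap : IsCurvatureMap (λ w x y z u →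
      s w z * t x y u - s x z * t w y u + s x y * t w z u - s w y * t x z u)
    product-isCurvatureMap = record
      { antisymmetry  = λ w x y z u → solve 4
          (λ a b c d → a :- b :+ c :- d := :- (d :- c :+ b :- a)) refl _ _ _ _
      ; pairSymmetry  = λ w x y z u → sym (trans
          (four (*-cong (s-sym y x) (t-sym₁₂ z w u)) (*-cong (s-sym z x) (t-sym₁₂ y w u))
                (*-cong (s-sym z w) (t-sym₁₂ y x u)) (*-cong (s-sym y w) (t-sym₁₂ z x u)))
          (solve 4 (λ a b c d → c :- b :+ a :- d := a :- b :+ c :- d) refl _ _ _ _))
      ; firstBianchi  = λ w x y z u → trans
          (+-cong (+-congˡ
            (four refl (*-congʳ (s-sym y x)) refl (*-congˡ (t-sym₁₂ y x u))))
            (four (*-congˡ (t-sym₁₂ z x u)) (*-congʳ (s-sym z y))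
                  (*-congʳ (s-sym z x)) (*-congˡ (t-sym₁₂ z y u))))
          (cancel _ _ _ _ _ _)
      ; secondBianchi = λ w x y z u → trans
          (+-cong (+-congˡ
            (four (*-congˡ (t-sym₂₃ x z y)) (*-congˡ (t-sym₂₃ w z y))
                  (*-congˡ (t-sym₂₃ w u y)) (*-congˡ (t-sym₂₃ x u y))))
            (four (*-congˡ (t-sym₂₃ x u z)) (*-congˡ (t-sym₂₃ w u z)) refl refl))
          (cancel′ _ _ _ _ _ _)
      }
      where
      four : ∀ {a b c d a′ b′ c′ d′} → a ≈ a′ → b ≈ b′ → c ≈ c′ → d ≈ d′ →
             a - b + c - d ≈ a′ - b′ + c′ - d′
      four p q r s = +-cong (+-cong (+-cong p (-‿cong q)) r) (-‿cong s)

      cancel : ∀ a b c d e f → (a - b + c - d) + (e - c + f - a) + (d - f + b - e) ≈ 0#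
      cancel = solve 6 (λ a b c d e f →
        (a :- b :+ c :- d) :+ (e :- c :+ f :- a) :+ (d :- f :+ b :- e) := con 0ℤ) refl

      cancel′ : ∀ a b c d e f → (a - b + c - d) + (e - f + b - a) + (d - c + f - e) ≈ 0#
      cancel′ = solve 6 (λ a b c d e f →
        (a :- b :+ c :- d) :+ (e :- f :+ b :- a) :+ (d :- c :+ f :- e) := con 0ℤ) refl

  module _ {f : (w x y z u : A) → Carrier} (F : IsCurvatureMap f) where

    -- The pair symmetry carries the antisymmetry over from the second pair to the first.
    IsCurvatureMap⇒skew : ∀ w x y z u → f w x y z u ≈ - f x w y z u
    IsCurvatureMap⇒skew w x y z u = begin
      f w x y z u    ≈⟨ pairSymmetry F w x y z u ⟩
      f y z w x u    ≈⟨ antisymmetry F y z w x u ⟩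
      - f y z x w u  ≈⟨ -‿cong (pairSymmetry F y z x w u) ⟩
      - f x w y z u  ∎

    private
      cyclic⇒ : ∀ {a b c} → a + b + c ≈ 0# → - c - b ≈ a
      cyclic⇒ {a} {b} {c} p = begin
        - c - b            ≈⟨ solve 3 (λ a b c → :- c :- b := a :- (a :+ b :+ c)) refl a b c ⟩
        a - (a + b + c)    ≈⟨ +-congˡ (trans (-‿cong p) ε⁻¹≈ε) ⟩
        a + 0#             ≈⟨ +-identityʳ a ⟩
        a                  ∎

      -- The first Bianchi identity in the shape in which `alternate-symmetrized₂` meets it: a
      -- difference of two terms that start with the same argument.
      firstBianchi′ : ∀ w x y z u → f y x w z u - f y w x z u ≈ f w x y z u
      firstBianchi′ w x y z u = trans
        (+-cong
          (trans (pairSymmetry F y x w z u) (antisymmetry F w z y x u))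
          (-‿cong (begin
            f y w x z u      ≈⟨ IsCurvatureMap⇒skew y w x z u ⟩
            - f w y x z u    ≈⟨ -‿cong (antisymmetry F w y x z u) ⟩
            - - f w y z x u  ≈⟨ solve 1 (λ a → :- :- a := a) refl _ ⟩
            f w y z x u      ∎)))
        (cyclic⇒ (firstBianchi F w x y z u))

    -- Order of the arguments: first those that are symmetrized, then those fixed in the second and
    -- fourth slots; here the last slot comes at the end.
    symmetrized₂ : (w y x z u : A) → Carrier
    symmetrized₂ w y x z u = f w x y z u + f y x w z u

    -- The map F(w, y, u; x, z) of the introduction, its six terms grouped by the argument in the
    -- last slot.
    symmetrized₃ : (w y u x z : A) → Carrier
    symmetrized₃ w y u x z =
      symmetrized₂ w y x z u + symmetrized₂ w u x z y + symmetrized₂ y u x z w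

    -- The pair symmetry exchanges `x` with `z` and also `w` with `y`; the symmetrization absorbs
    -- the latter.
    symmetrized₂-swap : ∀ w y x z u → symmetrized₂ w y x z u ≈ symmetrized₂ w y z x u
    symmetrized₂-swap w y x z u = trans (+-comm _ _)
      (+-cong (pairSymmetry F y x w z u) (pairSymmetry F w x y z u))

    symmetrized₃-swap : ∀ w y u x z → symmetrized₃ w y u x z ≈ symmetrized₃ w y u z x
    symmetrized₃-swap w y u x z = +-cong
      (+-cong (symmetrized₂-swap w y x z u) (symmetrized₂-swap w u x z y))
      (symmetrized₂-swap y u x z w)

    -- Two of the four terms equal `f w x y z u` by skewness in the first pair, and the other two
    -- add up to it by `firstBianchi′`.
    alternate-symmetrized₂ : ∀ w x y z u →
      symmetrized₂ w y x z u - symmetrized₂ x y w z u ≈ (3 ×ᴷ 1#) * f w x y z u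
    alternate-symmetrized₂ w x y z u = begin
      (a + b) - (f x w y z u + d)  ≈⟨ +-congˡ (-‿cong (+-congʳ (IsCurvatureMap⇒skew x w y z u))) ⟩
      (a + b) - (- a + d)          ≈⟨ solve 3 (λ a b d → (a :+ b) :- (:- a :+ d) :=
                                        con (+ 2) :* a :+ (b :- d)) refl a b d ⟩
      (2 ×ᴷ 1#) * a + (b - d)       ≈⟨ +-congˡ (firstBianchi′ w x y z u) ⟩
      (2 ×ᴷ 1#) * a + a             ≈⟨ solve 1 (λ a → con (+ 2) :* a :+ a := con (+ 3) :* a) refl a ⟩
      (3 ×ᴷ 1#) * a                 ∎
      where
      a = f w x y z u
      b = f y x w z u
      d = f y w x z u

    -- Symmetrization followed by alternation multiplies a curvature map by 12 = 24 / 2, where 24 is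
    -- the product of the hook lengths of the partition (3, 2) and the rows (2, 4) and (4, 2)
    -- contribute the same.
    alternate-symmetrized₃ : ∀ w x y z u →
      symmetrized₃ w y u x z - symmetrized₃ x y u w z - symmetrized₃ w z u x y + symmetrized₃ x z u w y
      ≈ (12 ×ᴷ 1#) * f w x y z u
    alternate-symmetrized₃ w x y z u = begin
      symmetrized₃ w y u x z - symmetrized₃ x y u w z - symmetrized₃ w z u x y + symmetrized₃ x z u w y
        -- Regroup by the argument in the last slot: u, then y and z, then w and x. Each difference
        -- is an alternation over one column.
        ≈⟨ solve 12 (λ a b c a′ b′ c′ d e f d′ e′ f′ →
             (a :+ b :+ c) :- (a′ :+ b′ :+ c′) :- (d :+ e :+ f) :+ (d′ :+ e′ :+ f′) :=
             (a :- a′) :- (d :- d′) :+ ((b :- b′) :- (e :- e′)) :+ ((c :- f) :- (c′ :- f′)))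
             refl _ _ _ _ _ _ _ _ _ _ _ _ ⟩
      (symmetrized₂ w y x z u - symmetrized₂ x y w z u) - (symmetrized₂ w z x y u - symmetrized₂ x z w y u)
      + ((symmetrized₂ w u x z y - symmetrized₂ x u w z y) - (symmetrized₂ w u x y z - symmetrized₂ x u w y z))
      + ((symmetrized₂ y u x z w - symmetrized₂ z u x y w) - (symmetrized₂ y u w z x - symmetrized₂ z u w y x))
        ≈⟨ +-cong
             (+-cong
               (difference (alternate-symmetrized₂ w x y z u) (trans (alternate-symmetrized₂ w x z y u)
                 (*-congˡ (antisymmetry F w x z y u))))
               (difference (trans (alternate-symmetrized₂ w x u z y) (*-congˡ (antisymmetry F w x u z y)))
                           (alternate-symmetrized₂ w x u y z)))
             (difference (last y z u x w)
                         (last′ y z u w x)) ⟩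
      k * a - k * - a + (k * - b - k * c) + (k * - d - k * e)
        -- The sum 6a - 3(b + c) - 3(d + e) is completed to two second Bianchi sums, each at the
        -- cost of 3a; hence 12.
        ≈⟨ solve 5 (λ a b c d e →
             con (+ 3) :* a :- con (+ 3) :* :- a :+ (con (+ 3) :* :- b :- con (+ 3) :* c)
               :+ (con (+ 3) :* :- d :- con (+ 3) :* e) :=
             con (+ 12) :* a :- con (+ 3) :* (a :+ b :+ c) :- con (+ 3) :* (a :+ d :+ e))
             refl a b c d e ⟩
      (12 ×ᴷ 1#) * a - k * (a + b + c) - k * (a + d + e)
        ≈⟨ +-cong (+-congˡ (vanish (secondBianchi F w x y z u)))
                  (vanish (trans (+-congʳ (+-congʳ (pairSymmetry F w x y z u))) (secondBianchi F y z w x u))) ⟩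
      (12 ×ᴷ 1#) * a + 0# + 0#
        ≈⟨ trans (+-identityʳ _) (+-identityʳ _) ⟩
      (12 ×ᴷ 1#) * a
        ∎
      where
      k = 3 ×ᴷ 1#
      a = f w x y z u
      b = f w x z u y
      c = f w x u y z
      d = f y z x u w
      e = f y z u w x

      difference : ∀ {a b a′ b′} → a ≈ a′ → b ≈ b′ → a - b ≈ a′ - b′
      difference p q = +-cong p (-‿cong q)

      last′ : ∀ y z u x w → symmetrized₂ y u x z w - symmetrized₂ z u x y w ≈ k * f y z u x w
      last′ y z u x w = trans
        (difference (symmetrized₂-swap y u x z w) (symmetrized₂-swap z u x y w))
        (alternate-symmetrized₂ y z u x w)

      last : ∀ y z u x w → symmetrized₂ y u x z w - symmetrized₂ z u x y w ≈ k * - f y z x u w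
      last y z u x w = trans (last′ y z u x w) (*-congˡ (antisymmetry F y z u x w))

      vanish : ∀ {a} → a ≈ 0# → - (k * a) ≈ 0#
      vanish p = trans (-‿cong (trans (*-congˡ p) (zeroʳ k))) ε⁻¹≈ε

-- The terms of the Young symmetrizer of t′

sort₂ : ∀ {n} → Fin n → Fin n → Vec (Fin n) 2
sort₂ a b = if toℕ a ℕ.≤ᵇ toℕ b then a Vec.∷ b Vec.∷ Vec.[] else b Vec.∷ a Vec.∷ Vec.[]

-- A sorting network of three comparisons of neighbours, so that `sort₃-invariant` can follow it by
-- adjacent swaps.
sort₃ : ∀ {n} → Fin n → Fin n → Fin n → Vec (Fin n) 3
sort₃ a b c with sort₂ a b
... | a Vec.∷ b Vec.∷ Vec.[] with sort₂ b c
... | b Vec.∷ c Vec.∷ Vec.[] with sort₂ a b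
... | a Vec.∷ b Vec.∷ Vec.[] = a Vec.∷ b Vec.∷ c Vec.∷ Vec.[]

mapʳ : ∀ {a b c} {A : Set a} {B : Set b} {C : Set c} → (A → B) → C × A → C × B
mapʳ f (c , a) = c , f a

-- With coefficients in `Sign` the list is independent of the ring and can be compared with a table
-- by evaluation.
signedYoung⋆ : ∀ {r} → YoungTableau r → List (Sign × Permutation′ r)
signedYoung⋆ t = concatMap
  (λ p → List.map (λ q → sign q , Perm.flip (q ∘ₚ p)) (columnGroup t))
  (rowGroup t)

images : ∀ {r} → Permutation′ r → Vec (Fin r) r
images p = Vec.tabulate (p ⟨$⟩ʳ_)

-- The vector a b c d e stands for the value S(vₐ, v_b) Ŝ(v_c, v_d, v_e); sorting a b and c d e turns
-- every term of y* (S ⊗ Ŝ) or y* (Ŝ ⊗ S) into one of the ten `products`, whose position is given by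
-- `pairIndex a b`.
pairIndex : Fin 5 → Fin 5 → Fin 10
pairIndex 0F 1F = 0F
pairIndex 0F 2F = 1F
pairIndex 0F 3F = 2F
pairIndex 0F 4F = 3F
pairIndex 1F 2F = 4F
pairIndex 1F 3F = 5F
pairIndex 1F 4F = 6F
pairIndex 2F 3F = 7F
pairIndex 2F 4F = 8F
pairIndex _  _  = 9F

sort-S⊗Ŝ sort-Ŝ⊗S : Vec (Fin 5) 5 → Vec (Fin 5) 5
sort-S⊗Ŝ (a Vec.∷ b Vec.∷ c Vec.∷ d Vec.∷ e Vec.∷ Vec.[]) = sort₂ a b Vec.++ sort₃ c d e
sort-Ŝ⊗S (c Vec.∷ d Vec.∷ e Vec.∷ a Vec.∷ b Vec.∷ Vec.[]) = sort₂ a b Vec.++ sort₃ c d e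

sorted-S⊗Ŝ sorted-Ŝ⊗S : Permutation′ 5 → Vec (Fin 5) 5
sorted-S⊗Ŝ p = sort-S⊗Ŝ (images p)
sorted-Ŝ⊗S p = sort-Ŝ⊗S (images p)

products : Vec (Vec (Fin 5) 5) 10
products =
  (0F Vec.∷ 1F Vec.∷ 2F Vec.∷ 3F Vec.∷ 4F Vec.∷ Vec.[]) Vec.∷
  (0F Vec.∷ 2F Vec.∷ 1F Vec.∷ 3F Vec.∷ 4F Vec.∷ Vec.[]) Vec.∷
  (0F Vec.∷ 3F Vec.∷ 1F Vec.∷ 2F Vec.∷ 4F Vec.∷ Vec.[]) Vec.∷
  (0F Vec.∷ 4F Vec.∷ 1F Vec.∷ 2F Vec.∷ 3F Vec.∷ Vec.[]) Vec.∷
  (1F Vec.∷ 2F Vec.∷ 0F Vec.∷ 3F Vec.∷ 4F Vec.∷ Vec.[]) Vec.∷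
  (1F Vec.∷ 3F Vec.∷ 0F Vec.∷ 2F Vec.∷ 4F Vec.∷ Vec.[]) Vec.∷
  (1F Vec.∷ 4F Vec.∷ 0F Vec.∷ 2F Vec.∷ 3F Vec.∷ Vec.[]) Vec.∷
  (2F Vec.∷ 3F Vec.∷ 0F Vec.∷ 1F Vec.∷ 4F Vec.∷ Vec.[]) Vec.∷
  (2F Vec.∷ 4F Vec.∷ 0F Vec.∷ 1F Vec.∷ 3F Vec.∷ Vec.[]) Vec.∷
  (3F Vec.∷ 4F Vec.∷ 0F Vec.∷ 1F Vec.∷ 2F Vec.∷ Vec.[]) Vec.∷ Vec.[]

-- The four elements of the column group of t′, in the order id, (34), (12), (12)(34); below, there is
-- one entry for each of the twelve elements of the row group.
signs : Vec (Fin 10) 4 → List (Sign × Fin 10)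
signs (i Vec.∷ j Vec.∷ k Vec.∷ l Vec.∷ Vec.[]) =
  (Sign.+ , i) List.∷ (Sign.- , j) List.∷ (Sign.- , k) List.∷ (Sign.+ , l) List.∷ List.[]

terms-S⊗Ŝ terms-Ŝ⊗S : List (Sign × Fin 10)
terms-S⊗Ŝ = concatMap signs (
  (0F Vec.∷ 0F Vec.∷ 0F Vec.∷ 0F Vec.∷ Vec.[]) List.∷
  (0F Vec.∷ 0F Vec.∷ 0F Vec.∷ 0F Vec.∷ Vec.[]) List.∷
  (2F Vec.∷ 1F Vec.∷ 5F Vec.∷ 4F Vec.∷ Vec.[]) List.∷
  (2F Vec.∷ 1F Vec.∷ 5F Vec.∷ 4F Vec.∷ Vec.[]) List.∷
  (4F Vec.∷ 5F Vec.∷ 1F Vec.∷ 2F Vec.∷ Vec.[]) List.∷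
  (6F Vec.∷ 6F Vec.∷ 3F Vec.∷ 3F Vec.∷ Vec.[]) List.∷
  (7F Vec.∷ 7F Vec.∷ 7F Vec.∷ 7F Vec.∷ Vec.[]) List.∷
  (9F Vec.∷ 8F Vec.∷ 9F Vec.∷ 8F Vec.∷ Vec.[]) List.∷
  (4F Vec.∷ 5F Vec.∷ 1F Vec.∷ 2F Vec.∷ Vec.[]) List.∷
  (6F Vec.∷ 6F Vec.∷ 3F Vec.∷ 3F Vec.∷ Vec.[]) List.∷
  (7F Vec.∷ 7F Vec.∷ 7F Vec.∷ 7F Vec.∷ Vec.[]) List.∷
  (9F Vec.∷ 8F Vec.∷ 9F Vec.∷ 8F Vec.∷ Vec.[]) List.∷ List.[])
terms-Ŝ⊗S = concatMap signs (
  (9F Vec.∷ 8F Vec.∷ 9F Vec.∷ 8F Vec.∷ Vec.[]) List.∷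
  (7F Vec.∷ 7F Vec.∷ 7F Vec.∷ 7F Vec.∷ Vec.[]) List.∷
  (6F Vec.∷ 6F Vec.∷ 3F Vec.∷ 3F Vec.∷ Vec.[]) List.∷
  (4F Vec.∷ 5F Vec.∷ 1F Vec.∷ 2F Vec.∷ Vec.[]) List.∷
  (9F Vec.∷ 8F Vec.∷ 9F Vec.∷ 8F Vec.∷ Vec.[]) List.∷
  (7F Vec.∷ 7F Vec.∷ 7F Vec.∷ 7F Vec.∷ Vec.[]) List.∷
  (6F Vec.∷ 6F Vec.∷ 3F Vec.∷ 3F Vec.∷ Vec.[]) List.∷
  (4F Vec.∷ 5F Vec.∷ 1F Vec.∷ 2F Vec.∷ Vec.[]) List.∷
  (2F Vec.∷ 1F Vec.∷ 5F Vec.∷ 4F Vec.∷ Vec.[]) List.∷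
  (2F Vec.∷ 1F Vec.∷ 5F Vec.∷ 4F Vec.∷ Vec.[]) List.∷
  (0F Vec.∷ 0F Vec.∷ 0F Vec.∷ 0F Vec.∷ Vec.[]) List.∷
  (0F Vec.∷ 0F Vec.∷ 0F Vec.∷ 0F Vec.∷ Vec.[]) List.∷ List.[])

_≟ᵗ_ : DecidableEquality (List (Sign × Vec (Fin 5) 5))
_≟ᵗ_ = List.≡-dec (Product.≡-dec Sign._≟_ (Vec.≡-dec Fin._≟_))

-- All that the proof uses about the tableau. Arguing for an arbitrary `t` with this property keeps
-- `y[ t ]` from being unfolded.
HasTerms : YoungTableau 5 → Set
HasTerms t =
  List.map (mapʳ sorted-S⊗Ŝ) (signedYoung⋆ t) ≡ List.map (mapʳ (Vec.lookup products)) terms-S⊗Ŝ ×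
  List.map (mapʳ sorted-Ŝ⊗S) (signedYoung⋆ t) ≡ List.map (mapʳ (Vec.lookup products)) terms-Ŝ⊗S

t′-hasTerms : HasTerms t′
t′-hasTerms = toWitness {a? = _ ≟ᵗ _} _ , toWitness {a? = _ ≟ᵗ _} _

sort₂-distinct : ∀ (a b : Fin 2) → a ≢ b → sort₂ a b ≡ Vec.allFin 2
sort₂-distinct = toWitness {a? = Fin.all? λ a → Fin.all? λ b →
  ¬? (a Fin.≟ b) →-dec Vec.≡-dec Fin._≟_ (sort₂ a b) (Vec.allFin 2)} _

sort₃-distinct : ∀ (a b c : Fin 3) → a ≢ b → b ≢ c → a ≢ c → sort₃ a b c ≡ Vec.allFin 3
sort₃-distinct = toWitness {a? = Fin.all? λ a → Fin.all? λ b → Fin.all? λ c →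
  ¬? (a Fin.≟ b) →-dec (¬? (b Fin.≟ c) →-dec (¬? (a Fin.≟ c) →-dec
    Vec.≡-dec Fin._≟_ (sort₃ a b c) (Vec.allFin 3)))} _

module _ {c ℓ m ℓm} {K : CommutativeRing c ℓ} (V : Module K m ℓm) where

  open CommutativeRing K
  open Module V
  open Tensors V
  open Tensor using (⟦⟧-cong; ⟦⟧-cong-≗; additive; homogeneous)
  open CurvatureMaps Carrierᴹ K
  open IntegerCoefficients K
    using (solve; prove; Polynomial; var; con; _:=_; _:+_; _:*_; _:-_; :-_) renaming (⟦_⟧ to ⟦_⟧ᴾ)
  open RingProperties ring using (-1*x≈-x)
  open SemiringMult semiring using (×-congʳ)
  open SemiringSum semiring using (sum; sum-cong-≋; ∑-distrib-+; *-distribˡ-sum)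
  open SetoidReasoning setoid

  -- Evaluation of symmetric tensors at listed arguments

  at₂ : Tensor 2 → Carrierᴹ → Carrierᴹ → Carrier
  at₂ S x y = ⟦ S ⟧ (x ∷ y ∷ [])

  at₃ : Tensor 3 → Carrierᴹ → Carrierᴹ → Carrierᴹ → Carrier
  at₃ Ŝ x y z = ⟦ Ŝ ⟧ (x ∷ y ∷ z ∷ [])

  -- Vectors are functions, so `v` and `v 0F ∷ v 1F ∷ []` agree only pointwise; this lemma and its
  -- analogues bring arguments into the listed form.
  at₂-≗ : ∀ S v → ⟦ S ⟧ v ≈ at₂ S (v 0F) (v 1F)
  at₂-≗ S v = ⟦⟧-cong-≗ S λ { 0F → ≡.refl ; 1F → ≡.refl }

  at₃-≗ : ∀ Ŝ v → ⟦ Ŝ ⟧ v ≈ at₃ Ŝ (v 0F) (v 1F) (v 2F)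
  at₃-≗ Ŝ v = ⟦⟧-cong-≗ Ŝ λ { 0F → ≡.refl ; 1F → ≡.refl ; 2F → ≡.refl }

  Symmetric⇒swap : ∀ {S} → Symmetric S → ∀ x y → at₂ S x y ≈ at₂ S y x
  Symmetric⇒swap {S} S-sym x y =
    trans (sym (S-sym (Perm.transpose 0F 1F) _)) (at₂-≗ S _)

  Symmetric⇒swap₁₂ : ∀ {Ŝ} → Symmetric Ŝ → ∀ x y z → at₃ Ŝ x y z ≈ at₃ Ŝ y x z
  Symmetric⇒swap₁₂ {Ŝ} Ŝ-sym x y z =
    trans (sym (Ŝ-sym (Perm.transpose 0F 1F) _)) (at₃-≗ Ŝ _)

  Symmetric⇒swap₂₃ : ∀ {Ŝ} → Symmetric Ŝ → ∀ x y z → at₃ Ŝ x y z ≈ at₃ Ŝ x z y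
  Symmetric⇒swap₂₃ {Ŝ} Ŝ-sym x y z =
    trans (sym (Ŝ-sym (Perm.transpose 1F 2F) _)) (at₃-≗ Ŝ _)

  module _ {f : Carrierᴹ → Carrierᴹ → Carrier} (f-sym : ∀ x y → f x y ≈ f y x) where

    sort₂-invariant : ∀ {n} (v : Vector Carrierᴹ n) a b →
      let w = Vec.map v (sort₂ a b) in
      f (Vec.lookup w 0F) (Vec.lookup w 1F) ≈ f (v a) (v b)
    sort₂-invariant v a b with toℕ a ℕ.≤ᵇ toℕ b
    ... | true  = refl
    ... | false = f-sym (v b) (v a)

  module _ {f : Carrierᴹ → Carrierᴹ → Carrierᴹ → Carrier}
           (f-sym₁₂ : ∀ x y z → f x y z ≈ f y x z) (f-sym₂₃ : ∀ x y z → f x y z ≈ f x z y) where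

    -- Each comparison in `sort₃` either does nothing or swaps two neighbouring arguments; `p`, `q`
    -- and `r` are the three steps.
    sort₃-invariant : ∀ {n} (v : Vector Carrierᴹ n) a b c →
      let w = Vec.map v (sort₃ a b c) in
      f (Vec.lookup w 0F) (Vec.lookup w 1F) (Vec.lookup w 2F) ≈ f (v a) (v b) (v c)
    sort₃-invariant v a b c with sort₂ a b | sort₂-invariant (λ x y → f-sym₁₂ x y (v c)) v a b
    ... | a Vec.∷ b Vec.∷ Vec.[] | p with sort₂ b c | sort₂-invariant (f-sym₂₃ (v a)) v b c
    ... | b Vec.∷ c Vec.∷ Vec.[] | q with sort₂ a b | sort₂-invariant (λ x y → f-sym₁₂ x y (v c)) v a b
    ... | a Vec.∷ b Vec.∷ Vec.[] | r = trans r (trans q p)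

  -- The starred Young symmetrizer as a signed sum

  signed : Sign → Carrier → Carrier
  signed Sign.+ x = x
  signed Sign.- x = - x

  signed-cong : ∀ σ {x y} → x ≈ y → signed σ x ≈ signed σ y
  signed-cong Sign.+ = λ p → p
  signed-cong Sign.- = -‿cong

  signedSum : ∀ {a} {A : Set a} → (A → Carrier) → List (Sign × A) → Carrier
  signedSum f = List.foldr (λ (σ , a) x → signed σ (f a) + x) 0#

  signedSum-cong : ∀ {a} {A : Set a} {f g : A → Carrier} → (∀ a → f a ≈ g a) →
                   ∀ as → signedSum f as ≈ signedSum g as
  signedSum-cong f≈g List.[]             = refl
  signedSum-cong f≈g ((σ , a) List.∷ as) = +-cong (signed-cong σ (f≈g a)) (signedSum-cong f≈g as)

  signedSum-map : ∀ {a b} {A : Set a} {B : Set b} (f : B → Carrier) (g : A → B) as →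
                  signedSum f (List.map (mapʳ g) as) ≡ signedSum (f ∘ g) as
  signedSum-map f g = List.foldr-map _ _ 0#

  -- `_⋆` acts term by term, so both sides list the same terms in the same order.
  young⋆-signed : ∀ {r} (t : YoungTableau r) → y[ t ] ⋆ ≡ List.map (map₁ fromSign) (signedYoung⋆ t)
  young⋆-signed t = ≡.trans
    (List.map-concatMap _ _ (rowGroup t))
    (≡.trans
      (List.concatMap-cong
        (λ p → ≡.trans (≡.sym (List.map-∘ (columnGroup t))) (List.map-∘ (columnGroup t)))
        (rowGroup t))
      (≡.sym (List.map-concatMap _ _ (rowGroup t))))

  ▷-signedSum : ∀ {r} (T : Tensor r) v ps →
                ⟦ List.map (map₁ fromSign) ps ▷ T ⟧ v ≈ signedSum (λ p → ⟦ T ⟧ (v ∘ (p ⟨$⟩ʳ_))) ps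
  ▷-signedSum T v List.[]             = refl
  ▷-signedSum T v ((σ , p) List.∷ ps) = +-cong (term σ) (▷-signedSum T v ps)
    where
    term : ∀ σ → fromSign σ * ⟦ T ⟧ (v ∘ (p ⟨$⟩ʳ_)) ≈ signed σ (⟦ T ⟧ (v ∘ (p ⟨$⟩ʳ_)))
    term Sign.+ = *-identityˡ _
    term Sign.- = -1*x≈-x _

  young⋆-signedSum : ∀ {r} (t : YoungTableau r) (T : Tensor r) v →
                     ⟦ y[ t ] ⋆ ▷ T ⟧ v ≈ signedSum (λ p → ⟦ T ⟧ (v ∘ (p ⟨$⟩ʳ_))) (signedYoung⋆ t)
  young⋆-signedSum t T v = trans
    (reflexive (≡.cong (λ a → ⟦ a ▷ T ⟧ v) (young⋆-signed t)))
    (▷-signedSum T v (signedYoung⋆ t))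

  -- The coordinate formula

  curvature : Tensor 2 → Tensor 3 → (v₁ v₂ v₃ v₄ v₅ : Carrierᴹ) → Carrier
  curvature S Ŝ v₁ v₂ v₃ v₄ v₅ =
    at₂ S v₁ v₄ * at₃ Ŝ v₂ v₃ v₅ - at₂ S v₂ v₄ * at₃ Ŝ v₁ v₃ v₅
    + at₂ S v₂ v₃ * at₃ Ŝ v₁ v₄ v₅ - at₂ S v₁ v₃ * at₃ Ŝ v₂ v₄ v₅

  module _ {S : Tensor 2} {Ŝ : Tensor 3} (S-sym : Symmetric S) (Ŝ-sym : Symmetric Ŝ)
           (v : Vector Carrierᴹ 5) where

    private
      product : Vec Carrierᴹ 5 → Carrier
      product (x Vec.∷ y Vec.∷ z Vec.∷ u Vec.∷ w Vec.∷ Vec.[]) = at₂ S x y * at₃ Ŝ z u w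

      signedP : Sign → Polynomial 10 → Polynomial 10
      signedP Sign.+ x = x
      signedP Sign.- x = :- x

      -- The counterpart of `signedSum` in the syntax of the solver, with one variable for each of
      -- the ten products.
      signedSumP : List (Sign × Fin 10) → Polynomial 10
      signedSumP = List.foldr (λ (σ , i) x → signedP σ (var i) :+ x) (con 0ℤ)

      ⟦signedSumP⟧ : ∀ ρ is → ⟦ signedSumP is ⟧ᴾ ρ ≡ signedSum (Vec.lookup ρ) is
      ⟦signedSumP⟧ ρ List.[] = ≡.refl
      ⟦signedSumP⟧ ρ ((Sign.+ , i) List.∷ is) = ≡.cong (λ x → _ + x) (⟦signedSumP⟧ ρ is)
      ⟦signedSumP⟧ ρ ((Sign.- , i) List.∷ is) = ≡.cong (λ x → _ + x) (⟦signedSumP⟧ ρ is)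

      sorted-product : ∀ a b c d e →
        product (Vec.map v (sort₂ a b Vec.++ sort₃ c d e)) ≈ at₂ S (v a) (v b) * at₃ Ŝ (v c) (v d) (v e)
      sorted-product a b c d e
        with sort₂ a b | sort₂-invariant (Symmetric⇒swap {S} S-sym) v a b
           | sort₃ c d e | sort₃-invariant (Symmetric⇒swap₁₂ {Ŝ} Ŝ-sym) (Symmetric⇒swap₂₃ {Ŝ} Ŝ-sym) v c d e
      ... | _ Vec.∷ _ Vec.∷ Vec.[] | p | _ Vec.∷ _ Vec.∷ _ Vec.∷ Vec.[] | q = *-cong p q

      value : Vec (Fin 5) 5 → Carrier
      value w = product (Vec.map v w)

      values : Vec Carrier 10
      values = Vec.map value products

      -- The value of a term depends only on its sorted form, so `eq` replaces the list coming from
      -- the tableau by the table, and what remains is a polynomial in the ten products.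
      young⋆-terms : ∀ t (T : Tensor 5) (sorted : Permutation′ 5 → Vec (Fin 5) 5) terms →
        (∀ p → ⟦ T ⟧ (v ∘ (p ⟨$⟩ʳ_)) ≈ value (sorted p)) →
        List.map (mapʳ sorted) (signedYoung⋆ t) ≡ List.map (mapʳ (Vec.lookup products)) terms →
        ⟦ y[ t ] ⋆ ▷ T ⟧ v ≈ ⟦ signedSumP terms ⟧ᴾ values
      young⋆-terms t T sorted terms T≈ eq = begin
        ⟦ y[ t ] ⋆ ▷ T ⟧ v
          ≈⟨ young⋆-signedSum t T v ⟩
        signedSum (λ p → ⟦ T ⟧ (v ∘ (p ⟨$⟩ʳ_))) (signedYoung⋆ t)
          ≈⟨ signedSum-cong T≈ (signedYoung⋆ t) ⟩
        signedSum (λ p → value (sorted p)) (signedYoung⋆ t)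
          ≡⟨ signedSum-map value sorted (signedYoung⋆ t) ⟨
        signedSum value (List.map (mapʳ sorted) (signedYoung⋆ t))
          ≡⟨ ≡.cong (signedSum value) eq ⟩
        signedSum value (List.map (mapʳ (Vec.lookup products)) terms)
          ≡⟨ signedSum-map value (Vec.lookup products) terms ⟩
        signedSum (λ i → value (Vec.lookup products i)) terms
          ≈⟨ signedSum-cong (λ i → reflexive (≡.sym (Vec.lookup-map i value products))) terms ⟩
        signedSum (Vec.lookup values) terms
          ≡⟨ ⟦signedSumP⟧ values terms ⟨
        ⟦ signedSumP terms ⟧ᴾ values ∎

      curvatureP 4×curvatureP : Polynomial 10
      curvatureP = var (pairIndex 0F 3F) :- var (pairIndex 1F 3F)
                   :+ var (pairIndex 1F 2F) :- var (pairIndex 0F 2F)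
      -- Written out so that its value is `4 ×ᴷ curvature …` by definition.
      4×curvatureP = curvatureP :+ (curvatureP :+ (curvatureP :+ (curvatureP :+ con 0ℤ)))

      -- The collection of the 48 terms, for arbitrary `ρ` so that the products remain atoms.
      terms-S⊗Ŝ-sum : ∀ ρ → ⟦ signedSumP terms-S⊗Ŝ ⟧ᴾ ρ ≈ ⟦ 4×curvatureP ⟧ᴾ ρ
      terms-S⊗Ŝ-sum ρ = prove ρ (signedSumP terms-S⊗Ŝ) 4×curvatureP refl

      terms-Ŝ⊗S-sum : ∀ ρ → ⟦ signedSumP terms-Ŝ⊗S ⟧ᴾ ρ ≈ ⟦ 4×curvatureP ⟧ᴾ ρ
      terms-Ŝ⊗S-sum ρ = prove ρ (signedSumP terms-Ŝ⊗S) 4×curvatureP refl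

    young⋆-S⊗Ŝ : ∀ t → HasTerms t →
      ⟦ y[ t ] ⋆ ▷ (S ⊗ Ŝ) ⟧ v ≈ 4 ×ᴷ curvature S Ŝ (v 0F) (v 1F) (v 2F) (v 3F) (v 4F)
    young⋆-S⊗Ŝ t (eq , _) = begin
      ⟦ y[ t ] ⋆ ▷ (S ⊗ Ŝ) ⟧ v          ≈⟨ young⋆-terms t (S ⊗ Ŝ) sorted-S⊗Ŝ terms-S⊗Ŝ S⊗Ŝ-sorted eq ⟩
      ⟦ signedSumP terms-S⊗Ŝ ⟧ᴾ values  ≈⟨ terms-S⊗Ŝ-sum values ⟩
      ⟦ 4×curvatureP ⟧ᴾ values          ∎
      where
      S⊗Ŝ-sorted : ∀ p → ⟦ S ⊗ Ŝ ⟧ (v ∘ (p ⟨$⟩ʳ_)) ≈ value (sorted-S⊗Ŝ p)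
      S⊗Ŝ-sorted p = trans (*-cong (at₂-≗ S _) (at₃-≗ Ŝ _)) (sym (sorted-product _ _ _ _ _))

    young⋆-Ŝ⊗S : ∀ t → HasTerms t →
      ⟦ y[ t ] ⋆ ▷ (Ŝ ⊗ S) ⟧ v ≈ 4 ×ᴷ curvature S Ŝ (v 0F) (v 1F) (v 2F) (v 3F) (v 4F)
    young⋆-Ŝ⊗S t (_ , eq) = begin
      ⟦ y[ t ] ⋆ ▷ (Ŝ ⊗ S) ⟧ v          ≈⟨ young⋆-terms t (Ŝ ⊗ S) sorted-Ŝ⊗S terms-Ŝ⊗S Ŝ⊗S-sorted eq ⟩
      ⟦ signedSumP terms-Ŝ⊗S ⟧ᴾ values  ≈⟨ terms-Ŝ⊗S-sum values ⟩
      ⟦ 4×curvatureP ⟧ᴾ values          ∎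
      where
      Ŝ⊗S-sorted : ∀ p → ⟦ Ŝ ⊗ S ⟧ (v ∘ (p ⟨$⟩ʳ_)) ≈ value (sorted-Ŝ⊗S p)
      Ŝ⊗S-sorted p = trans (*-cong (at₃-≗ Ŝ _) (at₂-≗ S _))
        (trans (*-comm _ _) (sym (sorted-product _ _ _ _ _)))

  -- Symmetric tensors

  permutation-≢ : ∀ {n} (p : Permutation′ n) {i j} → i ≢ j → p ⟨$⟩ʳ i ≢ p ⟨$⟩ʳ j
  permutation-≢ p i≢j eq = i≢j (Injection.injective (↔⇒↣ p) eq)

  -- Sorting the images of `p` restores the original order, and the value survives every swap made
  -- on the way. The same argument serves for order 3.
  swap⇒Symmetric₂ : ∀ {S : Tensor 2} → (∀ x y → at₂ S x y ≈ at₂ S y x) → Symmetric S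
  swap⇒Symmetric₂ {S} S-swap p v = begin
    ⟦ S ⟧ (v ∘ (p ⟨$⟩ʳ_))
      ≈⟨ at₂-≗ S _ ⟩
    at₂ S (v (p ⟨$⟩ʳ 0F)) (v (p ⟨$⟩ʳ 1F))
      ≈⟨ sort₂-invariant S-swap v (p ⟨$⟩ʳ 0F) (p ⟨$⟩ʳ 1F) ⟨
    value (sort₂ (p ⟨$⟩ʳ 0F) (p ⟨$⟩ʳ 1F))
      ≡⟨ ≡.cong value (sort₂-distinct _ _ (permutation-≢ p λ ())) ⟩
    at₂ S (v 0F) (v 1F)
      ≈⟨ at₂-≗ S v ⟨
    ⟦ S ⟧ v ∎
    where
    value : Vec (Fin 2) 2 → Carrier
    value w = let x = Vec.map v w in at₂ S (Vec.lookup x 0F) (Vec.lookup x 1F)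

  swap⇒Symmetric₃ : ∀ {T : Tensor 3} → (∀ x y z → at₃ T x y z ≈ at₃ T y x z) →
    (∀ x y z → at₃ T x y z ≈ at₃ T x z y) → Symmetric T
  swap⇒Symmetric₃ {T} T-swap₁₂ T-swap₂₃ p v = begin
    ⟦ T ⟧ (v ∘ (p ⟨$⟩ʳ_))
      ≈⟨ at₃-≗ T _ ⟩
    at₃ T (v (p ⟨$⟩ʳ 0F)) (v (p ⟨$⟩ʳ 1F)) (v (p ⟨$⟩ʳ 2F))
      ≈⟨ sort₃-invariant T-swap₁₂ T-swap₂₃ v (p ⟨$⟩ʳ 0F) (p ⟨$⟩ʳ 1F) (p ⟨$⟩ʳ 2F) ⟨
    value (sort₃ (p ⟨$⟩ʳ 0F) (p ⟨$⟩ʳ 1F) (p ⟨$⟩ʳ 2F))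
      ≡⟨ ≡.cong value (sort₃-distinct _ _ _
           (permutation-≢ p λ ()) (permutation-≢ p λ ()) (permutation-≢ p λ ())) ⟩
    at₃ T (v 0F) (v 1F) (v 2F)
      ≈⟨ at₃-≗ T v ⟨
    ⟦ T ⟧ v ∎
    where
    value : Vec (Fin 3) 3 → Carrier
    value w = let x = Vec.map v w in at₃ T (Vec.lookup x 0F) (Vec.lookup x 1F) (Vec.lookup x 2F)

  -- Not divided by 6: the constant 12 in `alternate-symmetrized₃` refers to this unnormalized sum.
  symmetrize : Tensor 3 → Tensor 3
  symmetrize T = sumᵀ (List.map (λ p → permute p T) (permutations 3))

  at₃-symmetrize : ∀ T x y z → let t = at₃ T in at₃ (symmetrize T) x y z ≈
    t x y z + t y x z + (t x z y + t z x y) + (t y z x + t z y x)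
  at₃-symmetrize T x y z = trans
    (+-cong (e _) (+-cong (e _) (+-cong (e _) (+-cong (e _) (+-cong (e _) (+-cong (e _) refl))))))
    -- `permutations 3` orders the terms by their first argument; they are regrouped by the last, as
    -- in `symmetrized₃`.
    (solve 6 (λ a b c d e f → a :+ (b :+ (c :+ (d :+ (e :+ (f :+ con 0ℤ))))) :=
      a :+ c :+ (b :+ e) :+ (d :+ f)) refl _ _ _ _ _ _)
    where
    e = at₃-≗ T

  symmetrize-Symmetric : ∀ T → Symmetric (symmetrize T)
  symmetrize-Symmetric T = swap⇒Symmetric₃ {symmetrize T}
    (λ x y z → trans (at₃-symmetrize T x y z) (trans
      (solve 6 (λ a b c d e f → a :+ b :+ (c :+ d) :+ (e :+ f) := b :+ a :+ (e :+ f) :+ (c :+ d))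
        refl _ _ _ _ _ _)
      (sym (at₃-symmetrize T y x z))))
    (λ x y z → trans (at₃-symmetrize T x y z) (trans
      (solve 6 (λ a b c d e f → a :+ b :+ (c :+ d) :+ (e :+ f) := c :+ d :+ (a :+ b) :+ (f :+ e))
        refl _ _ _ _ _ _)
      (sym (at₃-symmetrize T x z y))))

  -- Fixing arguments of a curvature tensor

  insert₀ : ∀ {r} → Carrierᴹ → Tensor (suc r) → Tensor r
  insert₀ a T = record
    { ⟦_⟧         = λ v → ⟦ T ⟧ (a ∷ v)
    ; ⟦⟧-cong     = λ v≈w → ⟦⟧-cong T λ { zero → ≈ᴹ-refl ; (suc i) → v≈w i }
    ; additive    = λ v i x y → trans (move v i (x +ᴹ y))
        (trans (additive T (a ∷ v) (suc i) x y) (sym (+-cong (move v i x) (move v i y))))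
    ; homogeneous = λ v i b x → trans (move v i (b *ₗ x))
        (trans (homogeneous T (a ∷ v) (suc i) b x) (*-congˡ (sym (move v i x))))
    }
    where
    move : ∀ v i x → ⟦ T ⟧ (a ∷ (v [ i ]≔ x)) ≈ ⟦ T ⟧ ((a ∷ v) [ suc i ]≔ x)
    move v i x = ⟦⟧-cong-≗ T λ { zero → ≡.refl ; (suc j) → ≡.refl }

  at₅ : Tensor 5 → (w x y z u : Carrierᴹ) → Carrier
  at₅ R w x y z u = ⟦ R ⟧ (w ∷ x ∷ y ∷ z ∷ u ∷ [])

  at₅-≗ : ∀ R v → ⟦ R ⟧ v ≈ at₅ R (v 0F) (v 1F) (v 2F) (v 3F) (v 4F)
  at₅-≗ R v = ⟦⟧-cong-≗ R
    λ { 0F → ≡.refl ; 1F → ≡.refl ; 2F → ≡.refl ; 3F → ≡.refl ; 4F → ≡.refl }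

  -- The second transposition moves b to its place but also exchanges the first two free arguments,
  -- which does not matter after symmetrization.
  fixEven : Carrierᴹ → Carrierᴹ → Tensor 5 → Tensor 3
  fixEven a b R =
    insert₀ b (permute (Perm.transpose 0F 2F) (insert₀ a (permute (Perm.transpose 0F 1F) R)))

  at₃-fixEven : ∀ a b R x y z → at₃ (fixEven a b R) x y z ≈ at₅ R y a x b z
  at₃-fixEven a b R x y z = at₅-≗ R _

  IsCovariantDerivativeCurvature⇒IsCurvatureMap : ∀ {R} →
    IsCovariantDerivativeCurvature R → IsCurvatureMap (at₅ R)
  IsCovariantDerivativeCurvature⇒IsCurvatureMap C = record
    { antisymmetry  = λ w x y z u → antisymmetry u w x y z
    ; pairSymmetry  = λ w x y z u → pairSymmetry u w x y z
    ; firstBianchi  = λ w x y z u → firstBianchi u w x y z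
    ; secondBianchi = λ w x y z u → secondBianchi u w x y z
    }
    where open IsCovariantDerivativeCurvature C

  IsCurvatureMap⇒IsCovariantDerivativeCurvature : ∀ {R} →
    IsCurvatureMap (at₅ R) → IsCovariantDerivativeCurvature R
  IsCurvatureMap⇒IsCovariantDerivativeCurvature C = record
    { antisymmetry  = λ u w x y z → antisymmetry w x y z u
    ; pairSymmetry  = λ u w x y z → pairSymmetry w x y z u
    ; firstBianchi  = λ u w x y z → firstBianchi w x y z u
    ; secondBianchi = λ u w x y z → secondBianchi w x y z u
    }
    where open IsCurvatureMap C

  -- Expansion in a basis

  record IsLinear (g : Carrierᴹ → Carrier) : Set (c ⊔ ℓ ⊔ m ⊔ ℓm) where
    field
      linear-cong : ∀ {x y} → x ≈ᴹ y → g x ≈ g y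
      linear-+    : ∀ x y → g (x +ᴹ y) ≈ g x + g y
      linear-*    : ∀ a x → g (a *ₗ x) ≈ a * g x

  open IsLinear

  IsLinear-resp-≈ : ∀ {g h} → (∀ x → g x ≈ h x) → IsLinear g → IsLinear h
  IsLinear-resp-≈ g≈h G = record
    { linear-cong = λ x≈y → trans (sym (g≈h _)) (trans (linear-cong G x≈y) (g≈h _))
    ; linear-+    = λ x y → trans (sym (g≈h _)) (trans (linear-+ G x y) (+-cong (g≈h x) (g≈h y)))
    ; linear-*    = λ a x → trans (sym (g≈h _)) (trans (linear-* G a x) (*-congˡ (g≈h x)))
    }

  +-isLinear : ∀ {g h} → IsLinear g → IsLinear h → IsLinear (λ x → g x + h x)
  +-isLinear G H = record
    { linear-cong = λ x≈y → +-cong (linear-cong G x≈y) (linear-cong H x≈y)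
    ; linear-+    = λ x y → trans (+-cong (linear-+ G x y) (linear-+ H x y))
        (solve 4 (λ a b c d → (a :+ b) :+ (c :+ d) := (a :+ c) :+ (b :+ d)) refl _ _ _ _)
    ; linear-*    = λ a x → trans (+-cong (linear-* G a x) (linear-* H a x)) (sym (distribˡ a _ _))
    }

  slot-isLinear : ∀ {r} (T : Tensor r) v i → IsLinear (λ x → ⟦ T ⟧ (v [ i ]≔ x))
  slot-isLinear T v i = record
    { linear-cong = λ {x} {y} x≈y → ⟦⟧-cong T (update-cong x≈y)
    ; linear-+    = additive T v i
    ; linear-*    = homogeneous T v i
    }
    where
    update-cong : ∀ {x y} → x ≈ᴹ y → ∀ j → (v [ i ]≔ x) j ≈ᴹ (v [ i ]≔ y) j
    update-cong {x} {y} x≈y j with j Fin.≟ i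
    ... | yes ≡.refl = ≈ᴹ-trans (≈ᴹ-reflexive (updateAt-updates j v))
                         (≈ᴹ-trans x≈y (≈ᴹ-reflexive (≡.sym (updateAt-updates j v))))
    ... | no  j≢i    = ≈ᴹ-reflexive (≡.trans (updateAt-minimal j i v j≢i)
                         (≡.sym (updateAt-minimal j i v j≢i)))

  linear-sum : ∀ {g} → IsLinear g → ∀ {n} (a : Vector Carrier n) e →
               g (LinearCombination a e) ≈ sum (λ i → a i * g (e i))
  linear-sum {g} G {zero}  a e = begin
    g 0ᴹ            ≈⟨ linear-cong G (*ₗ-zeroˡ 0ᴹ) ⟨
    g (0# *ₗ 0ᴹ)    ≈⟨ linear-* G 0# 0ᴹ ⟩
    0# * g 0ᴹ       ≈⟨ zeroˡ _ ⟩
    0#              ∎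
  linear-sum {g} G {suc n} a e = trans (linear-+ G _ _)
    (+-cong (linear-* G _ _) (linear-sum G (a ∘ suc) (e ∘ suc)))

  -- The two scalars let one statement serve differences, sums and, with `b` equal to 0, multiples
  -- of coordinate vectors.
  LinearCombination-linear : ∀ {n} a b (x y : Vector Carrier n) e →
    LinearCombination (λ i → a * x i + b * y i) e ≈ᴹ a *ₗ LinearCombination x e +ᴹ b *ₗ LinearCombination y e
  LinearCombination-linear {zero}  a b x y e =
    ≈ᴹ-sym (≈ᴹ-trans (+ᴹ-cong (*ₗ-zeroʳ a) (*ₗ-zeroʳ b)) (+ᴹ-identityˡ 0ᴹ))
  LinearCombination-linear {suc n} a b x y e = ≈ᴹ-trans
    (+ᴹ-cong (≈ᴹ-trans (*ₗ-distribʳ _ _ _) (+ᴹ-cong (*ₗ-assoc _ _ _) (*ₗ-assoc _ _ _)))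
             (LinearCombination-linear a b (x ∘ suc) (y ∘ suc) (e ∘ suc)))
    (≈ᴹ-trans (interchange _ _ _ _) (≈ᴹ-sym (+ᴹ-cong (*ₗ-distribˡ a _ _) (*ₗ-distribˡ b _ _))))
    where
    open SemigroupProperties (CommutativeMonoid.commutativeSemigroup +ᴹ-commutativeMonoid) using (interchange)

  module _ {n} {e : Vector Carrierᴹ n} (basis : IsBasis e) where

    open IsBasis basis

    coordinates : Carrierᴹ → Vector Carrier n
    coordinates v = proj₁ (spanning v)

    coordinates-expand : ∀ v → LinearCombination (coordinates v) e ≈ᴹ v
    coordinates-expand v = proj₂ (spanning v)

    -- Independence is applied to the difference of the two coefficient vectors. Uniqueness is what
    -- makes the coefficients chosen by `spanning` respect equality and depend linearly on `v`.
    coordinates-unique : ∀ v a → LinearCombination a e ≈ᴹ v → ∀ i → coordinates v i ≈ a i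
    coordinates-unique v a a≈v i = begin
      coordinates v i
        ≈⟨ solve 2 (λ x y → x := (con 1ℤ :* x :+ con -1ℤ :* y) :+ y) refl _ _ ⟩
      (k * coordinates v i + - k * a i) + a i
        ≈⟨ +-congʳ (independent _ zero-combination i) ⟩
      0# + a i
        ≈⟨ +-identityˡ _ ⟩
      a i
        ∎
      where
      -- The form in which the solver reads `con 1ℤ`; it unfolds to `1# + 0#`.
      k = 1 ×ᴷ 1#
      zero-combination : LinearCombination (λ i → k * coordinates v i + - k * a i) e ≈ᴹ 0ᴹ
      zero-combination = ≈ᴹ-trans (LinearCombination-linear k (- k) _ a e)
        (≈ᴹ-trans (+ᴹ-cong (*ₗ-congˡ (coordinates-expand v)) (*ₗ-congˡ a≈v))
          (≈ᴹ-trans (≈ᴹ-sym (*ₗ-distribʳ v k (- k)))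
            (≈ᴹ-trans (*ₗ-congʳ (-‿inverseʳ k)) (*ₗ-zeroˡ v))))

    coordinate-isLinear : ∀ i → IsLinear (λ v → coordinates v i)
    coordinate-isLinear i = record
      { linear-cong = λ {x} {y} x≈y →
          coordinates-unique x _ (≈ᴹ-trans (coordinates-expand y) (≈ᴹ-sym x≈y)) i
      ; linear-+    = λ x y → trans
          (coordinates-unique (x +ᴹ y) (λ i → 1# * coordinates x i + 1# * coordinates y i)
            (≈ᴹ-trans (LinearCombination-linear 1# 1# _ _ e)
              (+ᴹ-cong (≈ᴹ-trans (*ₗ-identityˡ _) (coordinates-expand x))
                       (≈ᴹ-trans (*ₗ-identityˡ _) (coordinates-expand y)))) i)
          (+-cong (*-identityˡ _) (*-identityˡ _))
      ; linear-*    = λ a x → trans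
          (coordinates-unique (a *ₗ x) (λ i → a * coordinates x i + 0# * coordinates x i)
            (≈ᴹ-trans (LinearCombination-linear a 0# _ _ e)
              (≈ᴹ-trans (+ᴹ-cong (*ₗ-congˡ (coordinates-expand x)) (*ₗ-zeroˡ _))
                (+ᴹ-identityʳ _))) i)
          (trans (+-congˡ (zeroˡ _)) (+-identityʳ _))
      }

    dual : Fin n → Tensor 1
    dual i = record
      { ⟦_⟧         = λ v → coordinates (v 0F) i
      ; ⟦⟧-cong     = λ v≈w → linear-cong (coordinate-isLinear i) (v≈w 0F)
      ; additive    = λ { v 0F x y → linear-+ (coordinate-isLinear i) x y }
      ; homogeneous = λ { v 0F a x → linear-* (coordinate-isLinear i) a x }
      }

    expand : ∀ {g} → IsLinear g → ∀ x → g x ≈ sum (λ i → coordinates x i * g (e i))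
    expand G x = trans (linear-cong G (≈ᴹ-sym (coordinates-expand x))) (linear-sum G (coordinates x) e)

    expand₂ : ∀ {h : Carrierᴹ → Carrierᴹ → Carrier} →
      (∀ y → IsLinear (λ x → h x y)) → (∀ x → IsLinear (h x)) → ∀ x y →
      h x y ≈ sum (λ i → sum (λ j → coordinates x i * coordinates y j * h (e i) (e j)))
    expand₂ {h} H₁ H₂ x y = begin
      h x y
        ≈⟨ expand (H₁ y) x ⟩
      sum (λ i → coordinates x i * h (e i) y)
        ≈⟨ sum-cong-≋ {n} (λ i → trans (*-congˡ (expand (H₂ (e i)) y)) (trans
             (*-distribˡ-sum {n} (coordinates x i) _)
             (sum-cong-≋ {n} λ j → sym (*-assoc _ _ _)))) ⟩
      sum (λ i → sum (λ j → coordinates x i * coordinates y j * h (e i) (e j)))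
        ∎

    -- Applied to the inner and then to the outer sum, this moves the double sum inside the
    -- alternation.
    sum-alternating : ∀ {n} k (f₁ f₂ f₃ f₄ : Vector Carrier n) →
      sum (λ i → k * (f₁ i - f₂ i + f₃ i - f₄ i)) ≈ k * (sum f₁ - sum f₂ + sum f₃ - sum f₄)
    sum-alternating {zero}  k f₁ f₂ f₃ f₄ =
      solve 1 (λ k → con 0ℤ := k :* (con 0ℤ :- con 0ℤ :+ con 0ℤ :- con 0ℤ)) refl k
    sum-alternating {suc n} k f₁ f₂ f₃ f₄ = trans
      (+-congˡ (sum-alternating k (f₁ ∘ suc) (f₂ ∘ suc) (f₃ ∘ suc) (f₄ ∘ suc)))
      (solve 9 (λ k a b c d a′ b′ c′ d′ →
        k :* (a :- b :+ c :- d) :+ k :* (a′ :- b′ :+ c′ :- d′) :=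
        k :* ((a :+ a′) :- (b :+ b′) :+ (c :+ c′) :- (d :+ d′))) refl k _ _ _ _ _ _ _ _)

    -- The value of φᵢ ⊗ φⱼ + φⱼ ⊗ φᵢ at (x, y).
    pairing : (x y : Carrierᴹ) (i j : Fin n) → Carrier
    pairing x y i j = coordinates x i * coordinates y j + coordinates x j * coordinates y i

    -- The two halves of `pairing` are the expansions of `h` at (x, y) and at (y, x), which agree by
    -- symmetry; hence the factor 2.
    sum-pairing : ∀ {h : Carrierᴹ → Carrierᴹ → Carrier} →
      (∀ x y → h x y ≈ h y x) → (∀ x → IsLinear (h x)) → ∀ x y →
      sum (λ i → sum (λ j → pairing x y i j * h (e i) (e j))) ≈ (2 ×ᴷ 1#) * h x y
    sum-pairing {h} h-sym H x y = begin
      sum (λ i → sum (λ j → pairing x y i j * h (e i) (e j)))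
        ≈⟨ sum-cong-≋ {n} (λ i → trans
             (sum-cong-≋ {n} λ j → trans (distribʳ _ _ _) (+-congˡ (*-congʳ (*-comm _ _))))
             (∑-distrib-+ {n} _ _)) ⟩
      sum (λ i → sum (λ j → coordinates x i * coordinates y j * h (e i) (e j))
               + sum (λ j → coordinates y i * coordinates x j * h (e i) (e j)))
        ≈⟨ ∑-distrib-+ {n} _ _ ⟩
      sum (λ i → sum (λ j → coordinates x i * coordinates y j * h (e i) (e j)))
      + sum (λ i → sum (λ j → coordinates y i * coordinates x j * h (e i) (e j)))
        ≈⟨ +-cong (expand₂ H′ H x y) (expand₂ H′ H y x) ⟨
      h x y + h y x
        ≈⟨ +-congˡ (h-sym y x) ⟩
      h x y + h x y
        ≈⟨ solve 1 (λ a → a :+ a := con (+ 2) :* a) refl _ ⟩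
      (2 ×ᴷ 1#) * h x y
        ∎
      where
      H′ : ∀ y → IsLinear (λ x → h x y)
      H′ y = IsLinear-resp-≈ (λ x → h-sym y x) (H y)

    -- Finite sums carry no coefficients, so the scalar is absorbed into the tensor of order 2.
    symmetricDual : Carrier → Fin n → Fin n → Tensor 2
    symmetricDual k i j = k *ᵀ (dual i ⊗ dual j +ᵀ dual j ⊗ dual i)

    symmetricDual-Symmetric : ∀ k i j → Symmetric (symmetricDual k i j)
    symmetricDual-Symmetric k i j = swap⇒Symmetric₂ {symmetricDual k i j} λ x y →
      *-congˡ (trans (+-comm _ _) (+-cong (*-comm _ _) (*-comm _ _)))

    module _ {R : Tensor 5} (F : IsCurvatureMap (at₅ R)) where

      -- Both sides are grouped by the last argument; within each pair `fixEven` only reverses the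
      -- two terms.
      at₃-symmetrize-fixEven : ∀ a b x y z →
        at₃ (symmetrize (fixEven a b R)) x y z ≈ symmetrized₃ F x y z a b
      at₃-symmetrize-fixEven a b x y z = trans (at₃-symmetrize (fixEven a b R) x y z)
        (+-cong (+-cong (swap x y z) (swap x z y)) (swap y z x))
        where
        swap : ∀ x y z → at₃ (fixEven a b R) x y z + at₃ (fixEven a b R) y x z ≈ symmetrized₂ F x y a b z
        swap x y z = trans (+-comm _ _) (+-cong (at₃-fixEven a b R y x z) (at₃-fixEven a b R x y z))

      symmetrized₃-isLinear : ∀ x y z a → IsLinear (symmetrized₃ F x y z a)
      symmetrized₃-isLinear x y z a = +-isLinear (+-isLinear (two x y z) (two x z y)) (two y z x)
        where
        one : ∀ x y z → IsLinear (λ b → at₅ R x a y b z)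
        -- The second `a` is a placeholder, overwritten in slot `3F`.
        one x y z = IsLinear-resp-≈ (λ b → at₅-≗ R _) (slot-isLinear R (x ∷ a ∷ y ∷ a ∷ z ∷ []) 3F)
        two : ∀ x y z → IsLinear (λ b → symmetrized₂ F x y a b z)
        two x y z = +-isLinear (one x y z) (one y x z)

      component : Carrier → Fin n → Fin n → (w x y z u : Carrierᴹ) → Carrier
      component k i j = curvature (symmetricDual k i j) (symmetrize (fixEven (e i) (e j) R))

      -- 96 = 4 · 2 · 12: the 4 multiplies the components, the 2 comes from `sum-pairing` and the 12
      -- from `alternate-symmetrized₃`.
      sum-component : ∀ k w x y z u →
        sum (λ i → sum (λ j → 4 ×ᴷ component (- k) i j w x y z u)) ≈ ((96 ×ᴷ 1#) * k) * at₅ R w x y z u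
      sum-component k w x y z u = begin
        sum (λ i → sum (λ j → 4 ×ᴷ component (- k) i j w x y z u))
          ≈⟨ sum-cong-≋ {n} (λ i → sum-cong-≋ {n} λ j → trans
               (four (at₃-symmetrize-fixEven (e i) (e j) x y u) (at₃-symmetrize-fixEven (e i) (e j) w y u)
                     (at₃-symmetrize-fixEven (e i) (e j) w z u) (at₃-symmetrize-fixEven (e i) (e j) x z u))
               (scale k _ _ _ _ _ _ _ _)) ⟩
        sum (λ i → sum (λ j → k′ * (f w z x y u i j - f x z w y u i j + f x y w z u i j - f w y x z u i j)))
          ≈⟨ sum-cong-≋ {n} (λ i → sum-alternating {n} k′ _ _ _ _) ⟩
        sum (λ i → k′ * (sum (f w z x y u i) - sum (f x z w y u i) + sum (f x y w z u i) - sum (f w y x z u i)))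
          ≈⟨ sum-alternating {n} k′ _ _ _ _ ⟩
        k′ * (∑∑ w z x y u - ∑∑ x z w y u + ∑∑ x y w z u - ∑∑ w y x z u)
          ≈⟨ *-congˡ (+-cong (+-cong (+-cong (contract w z x y u) (-‿cong (contract x z w y u)))
                                     (contract x y w z u)) (-‿cong (contract w y x z u))) ⟩
        k′ * ((2 ×ᴷ 1#) * g x y u w z - (2 ×ᴷ 1#) * g w y u x z + (2 ×ᴷ 1#) * g w z u x y - (2 ×ᴷ 1#) * g x z u w y)
          -- The signs in `curvature` are opposite to those in `alternate-symmetrized₃`; the scalar
          -- `- k` compensates for this.
          ≈⟨ solve 5 (λ k a b c d →
               con (+ 4) :* :- k :* (con (+ 2) :* a :- con (+ 2) :* b :+ con (+ 2) :* c :- con (+ 2) :* d) :=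
               con (+ 8) :* k :* (b :- a :- c :+ d)) refl k _ _ _ _ ⟩
        (8 ×ᴷ 1#) * k * (g w y u x z - g x y u w z - g w z u x y + g x z u w y)
          ≈⟨ *-congˡ (alternate-symmetrized₃ F w x y z u) ⟩
        (8 ×ᴷ 1#) * k * ((12 ×ᴷ 1#) * at₅ R w x y z u)
          ≈⟨ solve 2 (λ k a → con (+ 8) :* k :* (con (+ 12) :* a) := con (+ 96) :* k :* a) refl k _ ⟩
        ((96 ×ᴷ 1#) * k) * at₅ R w x y z u
          ∎
        where
        g : (x y z a b : Carrierᴹ) → Carrier
        g = symmetrized₃ F

        k′ = (4 ×ᴷ 1#) * - k

        f : (a b x y z : Carrierᴹ) (i j : Fin n) → Carrier
        f a b x y z i j = pairing a b i j * g x y z (e i) (e j)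

        ∑∑ : (a b x y z : Carrierᴹ) → Carrier
        ∑∑ a b x y z = sum (λ i → sum (f a b x y z i))

        contract : ∀ a b x y z → ∑∑ a b x y z ≈ (2 ×ᴷ 1#) * g x y z a b
        contract a b x y z = sum-pairing (symmetrized₃-swap F x y z) (symmetrized₃-isLinear x y z) a b

        four : ∀ {s₁ s₂ s₃ s₄ a b c d a′ b′ c′ d′} → a ≈ a′ → b ≈ b′ → c ≈ c′ → d ≈ d′ →
               4 ×ᴷ (s₁ * a - s₂ * b + s₃ * c - s₄ * d) ≈ 4 ×ᴷ (s₁ * a′ - s₂ * b′ + s₃ * c′ - s₄ * d′)
        four p q r s = ×-congʳ 4 (+-cong (+-cong (+-cong (*-congˡ p) (-‿cong (*-congˡ q))) (*-congˡ r))
                                         (-‿cong (*-congˡ s)))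

        scale : ∀ k s₁ s₂ s₃ s₄ a b c d →
          4 ×ᴷ (- k * s₁ * a - - k * s₂ * b + - k * s₃ * c - - k * s₄ * d) ≈
          (4 ×ᴷ 1#) * - k * (s₁ * a - s₂ * b + s₃ * c - s₄ * d)
        scale = solve 9 (λ k s₁ s₂ s₃ s₄ a b c d →
          let x = :- k :* s₁ :* a :- :- k :* s₂ :* b :+ :- k :* s₃ :* c :- :- k :* s₄ :* d in
          x :+ (x :+ (x :+ (x :+ con 0ℤ))) :=
          con (+ 4) :* :- k :* (s₁ :* a :- s₂ :* b :+ s₃ :* c :- s₄ :* d)) refl

  -- Finite sums of tensors

  sumᵀ-tabulate : ∀ {r n} (T : Fin n → Tensor r) v →
                  ⟦ sumᵀ (List.tabulate T) ⟧ v ≈ sum (λ i → ⟦ T i ⟧ v)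
  sumᵀ-tabulate {n = zero}  T v = refl
  sumᵀ-tabulate {n = suc n} T v = +-congˡ (sumᵀ-tabulate (T ∘ suc) v)

  sumᵀ-++ : ∀ {r} (Ss Ts : List (Tensor r)) v →
            ⟦ sumᵀ (Ss List.++ Ts) ⟧ v ≈ ⟦ sumᵀ Ss ⟧ v + ⟦ sumᵀ Ts ⟧ v
  sumᵀ-++ List.[]       Ts v = sym (+-identityˡ _)
  sumᵀ-++ (S List.∷ Ss) Ts v = trans (+-congˡ (sumᵀ-++ Ss Ts v)) (sym (+-assoc _ _ _))

  sumᵀ-concat : ∀ {r} (Tss : List (List (Tensor r))) v →
                ⟦ sumᵀ (List.concat Tss) ⟧ v ≈ ⟦ sumᵀ (List.map sumᵀ Tss) ⟧ v
  sumᵀ-concat List.[]         v = refl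
  sumᵀ-concat (Ts List.∷ Tss) v = trans (sumᵀ-++ Ts (List.concat Tss) v) (+-congˡ (sumᵀ-concat Tss v))

  -- The property shared by S, Ŝ ↦ y* (S ⊗ Ŝ) and S, Ŝ ↦ y* (Ŝ ⊗ S), from which everything below is
  -- derived for both at once.
  Is4×curvature : (Tensor 2 → Tensor 3 → Tensor 5) → Set _
  Is4×curvature G = ∀ (S : Tensor 2) (Ŝ : Tensor 3) → Symmetric S → Symmetric Ŝ → ∀ v →
    ⟦ G S Ŝ ⟧ v ≈ 4 ×ᴷ curvature S Ŝ (v 0F) (v 1F) (v 2F) (v 3F) (v 4F)

  Is4×curvature-unique : ∀ {G G′} → Is4×curvature G → Is4×curvature G′ →
                         ∀ S Ŝ → Symmetric S → Symmetric Ŝ → G S Ŝ ≈ᵀ G′ S Ŝ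
  Is4×curvature-unique G≈ G′≈ S Ŝ S-sym Ŝ-sym v =
    trans (G≈ S Ŝ S-sym Ŝ-sym v) (sym (G′≈ S Ŝ S-sym Ŝ-sym v))

  Is4×curvature-coords : ∀ {G} → Is4×curvature G → ∀ S Ŝ → Symmetric S → Symmetric Ŝ →
    ∀ {n} (e : Vector Carrierᴹ n) (i j k l s : Fin n) →
    let S₂ = λ (a b : Fin n) → coords S e (a ∷ b ∷ [])
        Ŝ₃ = λ (a b c : Fin n) → coords Ŝ e (a ∷ b ∷ c ∷ [])
    in
    coords (G S Ŝ) e (i ∷ j ∷ k ∷ l ∷ s ∷ []) ≈
    4 ×ᴷ (S₂ i l * Ŝ₃ j k s - S₂ j l * Ŝ₃ i k s + S₂ j k * Ŝ₃ i l s - S₂ i k * Ŝ₃ j l s)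
  Is4×curvature-coords G≈ S Ŝ S-sym Ŝ-sym e i j k l s = trans (G≈ S Ŝ S-sym Ŝ-sym _)
    (×-congʳ 4 (sym (+-cong
      (+-cong (+-cong (*-cong (at₂-≗ S _) (at₃-≗ Ŝ _)) (-‿cong (*-cong (at₂-≗ S _) (at₃-≗ Ŝ _))))
              (*-cong (at₂-≗ S _) (at₃-≗ Ŝ _)))
      (-‿cong (*-cong (at₂-≗ S _) (at₃-≗ Ŝ _))))))

  -- Curvature tensors as finite sums of generators

  module _ (κ : Carrier) (96κ≈1 : (96 ×ᴷ 1#) * κ ≈ 1#) (finite : FiniteDimensional)
           (G : Tensor 2 → Tensor 3 → Tensor 5) (G≈4×curvature : Is4×curvature G) where

    IsGenerator : Tensor 5 → Set _
    IsGenerator T = ∃₂ λ (S : Tensor 2) (Ŝ : Tensor 3) → Symmetric S × Symmetric Ŝ × T ≈ᵀ G S Ŝ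

    -- A generator is four times a map as in `product-isCurvatureMap`, and the identities, being
    -- linear, pass to sums.
    generators-curvature : ∀ {Ts} → All IsGenerator Ts → IsCurvatureMap (at₅ (sumᵀ Ts))
    generators-curvature All.[] = 0-isCurvatureMap
    generators-curvature ((S , Ŝ , S-sym , Ŝ-sym , T≈G) All.∷ Gs) = +-isCurvatureMap
      (IsCurvatureMap-resp-≈
        (λ w x y z u → sym (trans (T≈G _) (G≈4×curvature S Ŝ S-sym Ŝ-sym _)))
        (×-isCurvatureMap 4 (product-isCurvatureMap
          (Symmetric⇒swap {S} S-sym) (Symmetric⇒swap₁₂ {Ŝ} Ŝ-sym) (Symmetric⇒swap₂₃ {Ŝ} Ŝ-sym))))
      (generators-curvature Gs)

    curvature≐generators : IsCovariantDerivativeCurvature ≐ FiniteSumsOf IsGenerator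
    proj₂ curvature≐generators {R} (Ts , Gs , R≈ΣTs) =
      IsCurvatureMap⇒IsCovariantDerivativeCurvature {R}
        (IsCurvatureMap-resp-≈ (λ w x y z u → sym (R≈ΣTs _)) (generators-curvature Gs))
    -- There is one generator for each pair of basis vectors. As 96κ = 1, `sum-component` with k = κ
    -- writes `R` as their double sum, which is then flattened into a single list.
    proj₁ curvature≐generators {R} R-curvature = List.concat Tss , All-Tss , λ v → begin
      ⟦ R ⟧ v
        ≈⟨ at₅-≗ R v ⟩
      at₅ R (v 0F) (v 1F) (v 2F) (v 3F) (v 4F)
        ≈⟨ trans (*-congʳ 96κ≈1) (*-identityˡ _) ⟨
      ((96 ×ᴷ 1#) * κ) * at₅ R (v 0F) (v 1F) (v 2F) (v 3F) (v 4F)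
        ≈⟨ sum-component basis {R} F κ (v 0F) (v 1F) (v 2F) (v 3F) (v 4F) ⟨
      sum (λ i → sum (λ j → 4 ×ᴷ component basis {R} F (- κ) i j (v 0F) (v 1F) (v 2F) (v 3F) (v 4F)))
        ≈⟨ sum-cong-≋ {n} (λ i → trans (sumᵀ-tabulate (T i) v)
             (sum-cong-≋ {n} λ j → G≈4×curvature _ _
               (symmetricDual-Symmetric basis (- κ) i j) (symmetrize-Symmetric (Û i j)) v)) ⟨
      sum (λ i → ⟦ sumᵀ (List.tabulate (T i)) ⟧ v)
        ≈⟨ sumᵀ-tabulate (λ i → sumᵀ (List.tabulate (T i))) v ⟨
      ⟦ sumᵀ (List.tabulate (λ i → sumᵀ (List.tabulate (T i)))) ⟧ v
        ≡⟨ ≡.cong (λ Ts → ⟦ sumᵀ Ts ⟧ v) (List.map-tabulate (λ i → List.tabulate (T i)) sumᵀ) ⟨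
      ⟦ sumᵀ (List.map sumᵀ Tss) ⟧ v
        ≈⟨ sumᵀ-concat Tss v ⟨
      ⟦ sumᵀ (List.concat Tss) ⟧ v
        ∎
      where
      F = IsCovariantDerivativeCurvature⇒IsCurvatureMap {R} R-curvature
      n = proj₁ finite
      e = proj₁ (proj₂ finite)
      basis = proj₂ (proj₂ finite)

      Û : Fin n → Fin n → Tensor 3
      Û i j = fixEven (e i) (e j) R

      T : Fin n → Fin n → Tensor 5
      T i j = G (symmetricDual basis (- κ) i j) (symmetrize (Û i j))

      Tss : List (List (Tensor 5))
      Tss = List.tabulate (λ i → List.tabulate (T i))

      All-Tss : All IsGenerator (List.concat Tss)
      All-Tss = All.concat⁺ (All.tabulate⁺ λ i → All.tabulate⁺ λ j →
        symmetricDual basis (- κ) i j , symmetrize (Û i j) ,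
        symmetricDual-Symmetric basis (- κ) i j , symmetrize-Symmetric (Û i j) , λ _ → refl)

  -- Both orders of the tensor product

  module _ (t : YoungTableau 5) (t-terms : HasTerms t) where

    private
      G₁ G₂ : Tensor 2 → Tensor 3 → Tensor 5
      G₁ S Ŝ = y[ t ] ⋆ ▷ (S ⊗ Ŝ)
      G₂ S Ŝ = y[ t ] ⋆ ▷ (Ŝ ⊗ S)

      S⊗Ŝ : Is4×curvature G₁
      S⊗Ŝ S Ŝ S-sym Ŝ-sym v = young⋆-S⊗Ŝ {S} {Ŝ} S-sym Ŝ-sym v t t-terms

      Ŝ⊗S : Is4×curvature G₂
      Ŝ⊗S S Ŝ S-sym Ŝ-sym v = young⋆-Ŝ⊗S {S} {Ŝ} S-sym Ŝ-sym v t t-terms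

    young⋆-⊗-comm : ∀ (S : Tensor 2) (Ŝ : Tensor 3) → Symmetric S → Symmetric Ŝ → y[ t ] ⋆ ▷ (S ⊗ Ŝ) ≈ᵀ y[ t ] ⋆ ▷ (Ŝ ⊗ S)
    young⋆-⊗-comm = Is4×curvature-unique {G₁} {G₂} S⊗Ŝ Ŝ⊗S

    young⋆-⊗-coords : ∀ (S : Tensor 2) (Ŝ : Tensor 3) → Symmetric S → Symmetric Ŝ →
      ∀ {n} (e : Vector Carrierᴹ n) (i j k l s : Fin n) →
      let S₂ = λ (a b : Fin n) → coords S e (a ∷ b ∷ [])
          Ŝ₃ = λ (a b c : Fin n) → coords Ŝ e (a ∷ b ∷ c ∷ [])
          formula = 4 ×ᴷ (S₂ i l * Ŝ₃ j k s - S₂ j l * Ŝ₃ i k s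
                          + S₂ j k * Ŝ₃ i l s - S₂ i k * Ŝ₃ j l s)
          ijkls = i ∷ j ∷ k ∷ l ∷ s ∷ []
      in
      (coords (y[ t ] ⋆ ▷ (S ⊗ Ŝ)) e ijkls ≈ formula) ×
      (coords (y[ t ] ⋆ ▷ (Ŝ ⊗ S)) e ijkls ≈ formula)
    young⋆-⊗-coords S Ŝ S-sym Ŝ-sym e i j k l s =
      Is4×curvature-coords {G₁} S⊗Ŝ S Ŝ S-sym Ŝ-sym e i j k l s ,
      Is4×curvature-coords {G₂} Ŝ⊗S S Ŝ S-sym Ŝ-sym e i j k l s

    module _ (κ : Carrier) (96κ≈1 : (96 ×ᴷ 1#) * κ ≈ 1#) (finite : FiniteDimensional) where

      curvature≐young⋆-S⊗Ŝ : IsCovariantDerivativeCurvature ≐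
        FiniteSumsOf (λ T → ∃₂ λ (S : Tensor 2) (Ŝ : Tensor 3) →
          Symmetric S × Symmetric Ŝ × T ≈ᵀ y[ t ] ⋆ ▷ (S ⊗ Ŝ))
      curvature≐young⋆-S⊗Ŝ = curvature≐generators κ 96κ≈1 finite G₁ S⊗Ŝ

      curvature≐young⋆-Ŝ⊗S : IsCovariantDerivativeCurvature ≐
        FiniteSumsOf (λ T → ∃₂ λ (S : Tensor 2) (Ŝ : Tensor 3) →
          Symmetric S × Symmetric Ŝ × T ≈ᵀ y[ t ] ⋆ ▷ (Ŝ ⊗ S))
      curvature≐young⋆-Ŝ⊗S = curvature≐generators κ 96κ≈1 finite G₂ Ŝ⊗S

-- The real and the complex case

1/96 : ∀ 𝕂 → let open CommutativeRing (scalars 𝕂) in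
       ∃ λ κ → RawMonoid._×_ +-rawMonoid 96 1# * κ ≈ 1#
-- The product is a constant sequence whose rational value evaluates to 1, so the Cauchy property of
-- the constant 1 is the required proof; likewise for real and imaginary parts.
1/96 real    = Reals.fromℚ (+ 1 ℚ./ 96) , Reals.ℝ.cauchy (Reals.fromℚ ℚ.1ℚ)
1/96 complex = (Reals.fromℚ (+ 1 ℚ./ 96) Complexification.+i Reals.fromℚ ℚ.0ℚ) ,
  (Reals.ℝ.cauchy (Reals.fromℚ ℚ.1ℚ) Complexification.,ᶜ Reals.ℝ.cauchy (Reals.fromℚ ℚ.0ℚ))

theorem1p9-for :
  ∀ (t : YoungTableau 5) → HasTerms t →
  ∀ (𝕂 : ScalarField) {m ℓm} (V : Module (scalars 𝕂) m ℓm) →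
  let open CommutativeRing (scalars 𝕂)
      open Module V
      open Tensors V
  in
  FiniteDimensional →
  (∀ (S : Tensor 2) (Ŝ : Tensor 3) → Symmetric S → Symmetric Ŝ →
    (y[ t ] ⋆ ▷ (S ⊗ Ŝ) ≈ᵀ y[ t ] ⋆ ▷ (Ŝ ⊗ S)) ×
    (∀ {n} (e : Vector Carrierᴹ n) → IsBasis e → ∀ (i j k l s : Fin n) →
      let S₂ = λ (a b : Fin n) → coords S e (a ∷ b ∷ [])
          Ŝ₃ = λ (a b c : Fin n) → coords Ŝ e (a ∷ b ∷ c ∷ [])
          formula = 4 ×ᴷ (S₂ i l * Ŝ₃ j k s - S₂ j l * Ŝ₃ i k s
                          + S₂ j k * Ŝ₃ i l s - S₂ i k * Ŝ₃ j l s)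
          ijkls = i ∷ j ∷ k ∷ l ∷ s ∷ []
      in
      (coords (y[ t ] ⋆ ▷ (S ⊗ Ŝ)) e ijkls ≈ formula) ×
      (coords (y[ t ] ⋆ ▷ (Ŝ ⊗ S)) e ijkls ≈ formula))) ×
  (IsCovariantDerivativeCurvature ≐
    FiniteSumsOf (λ T → ∃₂ λ (S : Tensor 2) (Ŝ : Tensor 3) →
      Symmetric S × Symmetric Ŝ × T ≈ᵀ y[ t ] ⋆ ▷ (S ⊗ Ŝ))) ×
  (IsCovariantDerivativeCurvature ≐
    FiniteSumsOf (λ T → ∃₂ λ (S : Tensor 2) (Ŝ : Tensor 3) →
      Symmetric S × Symmetric Ŝ × T ≈ᵀ y[ t ] ⋆ ▷ (Ŝ ⊗ S)))
theorem1p9-for t t-terms 𝕂 V finite =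
  (λ S Ŝ S-sym Ŝ-sym →
    young⋆-⊗-comm V t t-terms S Ŝ S-sym Ŝ-sym ,
    λ e _ → young⋆-⊗-coords V t t-terms S Ŝ S-sym Ŝ-sym e) ,
  curvature≐young⋆-S⊗Ŝ V t t-terms κ 96κ≈1 finite ,
  curvature≐young⋆-Ŝ⊗S V t t-terms κ 96κ≈1 finite
  where
  κ = proj₁ (1/96 𝕂)
  96κ≈1 = proj₂ (1/96 𝕂)

-- Each `open Tensors V` introduces its own aliases.  Writing out the type above with t′ for t would
-- make the type checker compare two sets of aliases, which unfolds all terms of y[ t′ ] and does not
-- end in practice; the inferred type needs no comparison.
theorem1p9 : _
theorem1p9 = theorem1p9-for t′ t′-hasTerms
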